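{- For every integer $n\geq 1$, $\mathrm{ex}_{\mathcal{P}}(n,S_{2,5})\leq \frac{20}{7}n$.
   Context: All graphs are finite and simple. For a graph $F$, the planar Turán number $\mathrm{ex}_{\mathcal{P}}(n,F)$ is the maximum number of edges in an $n$-vertex planar graph that contains no subgraph isomorphic to $F$. For positive integers $m,k$, the double star $S_{m,k}$ is the tree obtained from an edge $xy$ (the backbone) by joining $x$ to $m$ new vertices and $y$ to $k$ further new vertices, all these $m+k$ vertices distinct. -}

module Defs where

open import Data.Empty using (⊥)
open import Data.Fin.Base as Fin using (Fin; toℕ)
import Data.Fin.Properties as Fin
open import Data.Integer.Base using (+_)
import Data.Integer.Properties as ℤ
open import Data.List.Base using (List; []; _∷_; [_]; _++_; length; filter; allFin; cartesianProduct)
open import Data.List.Properties using (length-filter)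
open import Data.Nat.Base as ℕ using (ℕ; zero; suc)
import Data.Nat.Properties as ℕ
import Data.Nat.Coprimality as Coprime
open import Data.Product.Base using (Σ; ∃-syntax; _×_; _,_; proj₁)
open import Data.Rational.Base as ℚ using (ℚ; 0ℚ; 1ℚ; mkℚ)
open import Data.Sum.Base using (_⊎_)
open import Function.Base using (_∘_)
open import Function.Definitions using (Injective)
open import Level using (0ℓ)
open import Relation.Binary.Construct.Closure.Symmetric using (SymClosure; fwd; bwd; symmetric)
open import Relation.Binary.Core using (Rel)
open import Relation.Binary.Definitions using (Decidable; Symmetric; Irreflexive)
open import Relation.Binary.PropositionalEquality.Core using (_≡_; _≢_; refl; cong; subst)
open import Relation.Nullary using (¬_; yes; no; _×-dec_)
import Relation.Unary as U

-- Adjacency is required to be decidable so that edges can be counted;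
-- classically this is no restriction.
record SimpleGraph (V : Set) : Set₁ where
  infix 4 _~_ _~?_
  field
    _~_    : Rel V 0ℓ
    _~?_   : Decidable _~_
    ~-sym  : Symmetric _~_
    ~-irr  : Irreflexive _≡_ _~_

-- H contains a (not necessarily induced) subgraph isomorphic to F.
Contains : ∀ {V W} → SimpleGraph W → SimpleGraph V → Set
Contains {V} {W} H F =
  ∃[ f ] Injective _≡_ _≡_ f × (∀ {u v} → u F.~ v → f u H.~ f v)
  where
  module F = SimpleGraph F
  module H = SimpleGraph H

module _ {n : ℕ} (G : SimpleGraph (Fin n)) where
  open SimpleGraph G

  -- Every edge is represented once, by the pair (u , v) with u < v.
  IsEdge : U.Pred (Fin n × Fin n) 0ℓ
  IsEdge (u , v) = u Fin.< v × u ~ v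

  isEdge? : U.Decidable IsEdge
  isEdge? (u , v) = (u Fin.<? v) ×-dec (u ~? v)

  edgeCount : ℕ
  edgeCount = length (filter isEdge? (cartesianProduct (allFin n) (allFin n)))

data DSVertex (m k : ℕ) : Set where
  xᵉ yᵉ : DSVertex m k
  xleaf : Fin m → DSVertex m k
  yleaf : Fin k → DSVertex m k

data DSEdge {m k : ℕ} : Rel (DSVertex m k) 0ℓ where
  backbone : DSEdge xᵉ yᵉ
  xedge    : ∀ i → DSEdge xᵉ (xleaf i)
  yedge    : ∀ j → DSEdge yᵉ (yleaf j)

dsEdge? : ∀ {m k} → Decidable (DSEdge {m} {k})
dsEdge? xᵉ xᵉ = no λ ()
dsEdge? xᵉ yᵉ = yes backbone
dsEdge? xᵉ (xleaf i) = yes (xedge i)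
dsEdge? xᵉ (yleaf _) = no λ ()
dsEdge? yᵉ xᵉ = no λ ()
dsEdge? yᵉ yᵉ = no λ ()
dsEdge? yᵉ (xleaf _) = no λ ()
dsEdge? yᵉ (yleaf j) = yes (yedge j)
dsEdge? (xleaf _) _ = no λ ()
dsEdge? (yleaf _) _ = no λ ()

doubleStar : (m k : ℕ) → SimpleGraph (DSVertex m k)
doubleStar m k = record
  { _~_   = SymClosure DSEdge
  ; _~?_  = dec
  ; ~-sym = symmetric DSEdge
  ; ~-irr = λ { refl (fwd ()) ; refl (bwd ()) }
  }
  where
  dec : Decidable (SymClosure DSEdge)
  dec u v with dsEdge? u v | dsEdge? v u
  ... | yes e | _     = yes (fwd e)
  ... | no _  | yes e = yes (bwd e)
  ... | no ¬e | no ¬f = no λ { (fwd e) → ¬e e ; (bwd f) → ¬f f }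

-- A graph is planar if it can be drawn in the plane without crossings,
-- its edges being drawn as simple polygonal arcs.  There are no real
-- numbers here, so all vertices and bends have rational coordinates and
-- the plane is ℚ².  No planar graph is lost, since a polygonal drawing
-- can be perturbed to have rational bends; no crossing is missed, since
-- two segments with rational ends that meet in ℝ² meet in a rational
-- point.

Point : Set
Point = ℚ × ℚ

-- The point (1 - t) p + t q.
interpolate : Point → Point → ℚ → Point
interpolate (p₁ , p₂) (q₁ , q₂) t =
  (1ℚ ℚ.- t) ℚ.* p₁ ℚ.+ t ℚ.* q₁ , (1ℚ ℚ.- t) ℚ.* p₂ ℚ.+ t ℚ.* q₂

infix 4 _∈[_,_] _∈ₚ_

_∈[_,_] : Point → Point → Point → Set
a ∈[ p , q ] = ∃[ t ] 0ℚ ℚ.≤ t × t ℚ.≤ 1ℚ × a ≡ interpolate p q t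

-- Membership in the union of the segments joining consecutive points.
data _∈ₚ_ (a : Point) : List Point → Set where
  here  : ∀ {p q ps} → a ∈[ p , q ] → a ∈ₚ p ∷ q ∷ ps
  there : ∀ {p ps} → a ∈ₚ ps → a ∈ₚ p ∷ ps

-- The polygonal path does not meet itself: each segment shares with the
-- remainder of the path only the bend at which that remainder starts.
data IsArc : List Point → Set where
  segment : ∀ {p q} → p ≢ q → IsArc (p ∷ q ∷ [])
  _∷_     : ∀ {p q r ps} →
            (∀ a → a ∈[ p , q ] → a ∈ₚ q ∷ r ∷ ps → a ≡ q) →
            IsArc (q ∷ r ∷ ps) → IsArc (p ∷ q ∷ r ∷ ps)

_IsEndOf_ : ∀ {n} → Fin n → Fin n × Fin n → Set
w IsEndOf (u , v) = w ≡ u ⊎ w ≡ v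

record PlaneDrawing {n : ℕ} (G : SimpleGraph (Fin n)) : Set where
  field
    pos   : Fin n → Point
    -- The bends strictly between the two ends of an edge; the values at
    -- pairs that are not edges are irrelevant.
    bends : Fin n × Fin n → List Point

  arc : Fin n × Fin n → List Point
  arc (u , v) = pos u ∷ bends (u , v) ++ [ pos v ]

  field
    pos-injective : Injective _≡_ _≡_ pos
    arc-simple    : ∀ {e} → IsEdge G e → IsArc (arc e)
    arc-vertex    : ∀ {e} → IsEdge G e → ∀ w → pos w ∈ₚ arc e → w IsEndOf e
    arc-arc       : ∀ {e f} → IsEdge G e → IsEdge G f → e ≢ f →
                    ∀ a → a ∈ₚ arc e → a ∈ₚ arc f →
                    ∃[ w ] a ≡ pos w × w IsEndOf e × w IsEndOf f

Planar : ∀ {n} → SimpleGraph (Fin n) → Set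
Planar = PlaneDrawing

-- The value ex_P(n, F) is given by its graph, as the computation of the
-- maximum would need a decision procedure for planarity.
record IsPlanarTuránNumber {V : Set} (n : ℕ) (F : SimpleGraph V) (e : ℕ) : Set₁ where
  field
    attained : Σ (SimpleGraph (Fin n)) λ G →
               Planar G × ¬ Contains G F × edgeCount G ≡ e
    maximal  : (G : SimpleGraph (Fin n)) → Planar G → ¬ Contains G F →
               edgeCount G ℕ.≤ e

-- The maximum is unique and, as soon as F has an edge, exists
-- classically, so statements about it are not vacuous.

planarTurán-unique : ∀ {V n} {F : SimpleGraph V} {d e} →
  IsPlanarTuránNumber n F d → IsPlanarTuránNumber n F e → d ≡ e
planarTurán-unique {n = n} {F} p q = ℕ.≤-antisym (le p q) (le q p)
  where
  le : ∀ {d e} → IsPlanarTuránNumber n F d → IsPlanarTuránNumber n F e → d ℕ.≤ e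
  le p q with IsPlanarTuránNumber.attained p
  ... | G , pl , free , refl = IsPlanarTuránNumber.maximal q G pl free

private
  edgeless : ∀ n → SimpleGraph (Fin n)
  edgeless n = record
    { _~_   = λ _ _ → ⊥
    ; _~?_  = λ _ _ → no λ ()
    ; ~-sym = λ ()
    ; ~-irr = λ _ ()
    }

  edgeless-planar : ∀ n → Planar (edgeless n)
  edgeless-planar n = record
    { pos           = λ i → integer (toℕ i) , 0ℚ
    ; bends         = λ _ → []
    ; pos-injective = λ eq → Fin.toℕ-injective (ℤ.+-injective (cong (ℚ.numerator ∘ proj₁) eq))
    ; arc-simple    = λ { (_ , ()) }
    ; arc-vertex    = λ { (_ , ()) }
    ; arc-arc       = λ { (_ , ()) }
    }
    where
    integer : ℕ → ℚ
    integer k = mkℚ (+ k) 0 (Coprime.sym (Coprime.1-coprimeTo k))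

planarTurán-exists : ∀ {V} n (F : SimpleGraph V) →
  (let open SimpleGraph F) → ∀ {u v} → u ~ v →
  ¬ ¬ (∃[ e ] IsPlanarTuránNumber n F e)
planarTurán-exists n F uv none =
  climb bound (edgeless n) (edgeless-planar n) (λ { (_ , _ , hom) → hom uv }) (ℕ.m≤n+m bound _)
  where
  bound : ℕ
  bound = length (cartesianProduct (allFin n) (allFin n))

  climb : ∀ k (G : SimpleGraph (Fin n)) → Planar G → ¬ Contains G F →
          ¬ (bound ℕ.≤ edgeCount G ℕ.+ k)
  climb k G pl free b = none (edgeCount G , record
    { attained = G , pl , free , refl
    ; maximal  = λ H plH freeH → ℕ.≮⇒≥ (λ lt → step k b H plH freeH lt)
    })
    where
    step : ∀ k → bound ℕ.≤ edgeCount G ℕ.+ k → ∀ H → Planar H → ¬ Contains H F →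
           ¬ (edgeCount G ℕ.< edgeCount H)
    step zero b H _ _ lt = ℕ.<⇒≱ lt (ℕ.≤-trans (length-filter (isEdge? H) (cartesianProduct (allFin n) (allFin n)))
                             (subst (bound ℕ.≤_) (ℕ.+-identityʳ _) b))
    step (suc k) b H plH freeH lt = climb k H plH freeH
      (ℕ.≤-trans b (ℕ.≤-trans (ℕ.≤-reflexive (ℕ.+-suc _ k)) (ℕ.+-monoˡ-≤ k lt)))

{-# OPTIONS --safe #-}

-- K₃₃ is not planar, for the following reason.  For disjoint polygonal paths A
-- from p to q and B from a to b, count mod 2 how often p and q lie under B and
-- how often a and b lie under A: the result depends only on the horizontal order
-- of the four ends.  Fix three vertices b₀, b₁, b₂, and for a common neighbour a
-- count the pairs j ≠ l for which b_l lies under the edge a b_j.  Adding up the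
-- parity relations of all disjoint edges a b_j and a′ b_l, one finds that any two
-- common neighbours have different counts mod 2; hence there are no three.
--
-- The bound follows by discharging.  In an S₂,₅-free graph a vertex y of degree at
-- least 8 has only neighbours of degree at most 2, the closed neighbourhood of a
-- vertex y of degree 7 contains that of each neighbour of degree at least 3, and
-- each neighbour of a vertex y of degree 6 has at most one neighbour outside the
-- closed neighbourhood of y.  As there is no K₃₃, a vertex of degree 6 has at most
-- 4 neighbours of degree at least 6, and a vertex of degree 7 at most one.  So if
-- vertices of degree at most 2 give 13 to each neighbour and those of degree 3 to 5
-- give 1 to their neighbours of degree 6 and 2 to those of degree 7, every vertex
-- v ends up with 7 deg v at most 40.
module Submission where

open import Defs
open import Data.Bool.Base using (Bool; true; false; not; _∧_; _∨_; _xor_)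
open import Data.Bool.Properties using (∨-comm; ∧-zeroʳ; ∨-identityʳ; xor-comm)
open import Data.Bool.Solver using (module xor-∧-Solver)
open import Data.Empty using (⊥; ⊥-elim)
open import Data.Fin.Base as Fin using (Fin; zero; suc)
open import Data.Fin.Patterns
import Data.Fin.Properties as Fin
import Data.Integer.Base as ℤ
import Data.Integer.Properties as ℤ
open import Data.List.Base using (List; []; _∷_; _++_; [_]; map; length; filter; tabulate; cartesianProduct)
open import Data.List.Properties using (length-++; filter-++; map-tabulate)
open import Data.Nat.Base using (ℕ; _≥_)
open import Data.Product using (∃-syntax; _×_; _,_; proj₁; proj₂)
open import Data.Product.Relation.Binary.Lex.Strict using (×-strictTotalOrder)
import Data.Rational.Base as ℚ
import Data.Rational.Properties as ℚ
import Data.Rational.Unnormalised.Base as ℚᵘ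
import Data.Rational.Unnormalised.Properties as ℚᵘ
open import Data.Sum.Base using (_⊎_; inj₁; inj₂; [_,_]′)
open import Function.Base using (_∘_; const; id)
open import Function.Definitions using (Injective)
open import Level using (0ℓ)
open import Relation.Binary using (StrictTotalOrder; Tri; tri<; tri≈; tri>)
open import Relation.Binary.Construct.Closure.Symmetric using (fwd; bwd)
open import Relation.Binary.PropositionalEquality hiding ([_])
open import Relation.Nullary using (¬_; Dec; yes; no; does; _×-dec_; _⊎-dec_; ¬?)
open import Relation.Nullary.Decidable using (dec-true; dec-false; decidable-stable)
open import Relation.Unary using (Pred; Decidable)

open StrictTotalOrder (×-strictTotalOrder ℚ.<-strictTotalOrder ℚ.<-strictTotalOrder) using (_≈_)
  renaming (_<_ to _≺_; _<?_ to _≺?_; compare to ≺-cmp; trans to ≺-trans; irrefl to ≺-irrefl; asym to ≺-asym)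

-- Segments in ℚ²

module _ where
  open import Data.Rational.Base using (ℚ; 0ℚ; 1ℚ; _+_; _-_; _*_; -_; _≤_; _<_; 1/_; positive; nonNegative)
  open import Data.Rational.Properties hiding (_≟_)
  open import Data.Rational.Solver using (module +-*-Solver)
  open +-*-Solver using (Polynomial; solve; _:=_; _:+_; _:*_; _:-_; :-_; con)

  p<q⇒0<q-p : ∀ {p q} → p < q → 0ℚ < q - p
  p<q⇒0<q-p {p} {q} p<q = subst (_< q - p) (+-inverseʳ p) (+-monoˡ-< (- p) p<q)

  p≤q⇒0≤q-p : ∀ {p q} → p ≤ q → 0ℚ ≤ q - p
  p≤q⇒0≤q-p {p} {q} p≤q = subst (_≤ q - p) (+-inverseʳ p) (+-monoˡ-≤ (- p) p≤q)

  p-q+q≡p : ∀ p q → p - q + q ≡ p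
  p-q+q≡p = solve 2 (λ p q → p :- q :+ q := p) refl

  0≤q-p⇒p≤q : ∀ {p q} → 0ℚ ≤ q - p → p ≤ q
  0≤q-p⇒p≤q {p} {q} 0≤ = subst₂ _≤_ (+-identityˡ p) (p-q+q≡p q p) (+-monoˡ-≤ p 0≤)

  p-q<0⇒p<q : ∀ {p q} → p - q < 0ℚ → p < q
  p-q<0⇒p<q {p} {q} <0 = subst₂ _<_ (p-q+q≡p p q) (+-identityˡ q) (+-monoˡ-< q <0)

  0<p-q⇒q<p : ∀ {p q} → 0ℚ < p - q → q < p
  0<p-q⇒q<p {p} {q} 0< = subst₂ _<_ (+-identityˡ q) (p-q+q≡p p q) (+-monoˡ-< q 0<)

  *-pos : ∀ {p q} → 0ℚ < p → 0ℚ < q → 0ℚ < p * q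
  *-pos {p} {q} 0<p 0<q = positive⁻¹ _ {{pos*pos⇒pos p {{positive 0<p}} q {{positive 0<q}}}}

  *-nonNeg : ∀ {p q} → 0ℚ ≤ p → 0ℚ ≤ q → 0ℚ ≤ p * q
  *-nonNeg {p} {q} 0≤p 0≤q = nonNegative⁻¹ _ {{nonNeg*nonNeg⇒nonNeg p {{nonNegative 0≤p}} q {{nonNegative 0≤q}}}}

  infixl 6 _⊖_
  _⊖_ : Point → Point → Point
  (q₁ , q₂) ⊖ (p₁ , p₂) = q₁ - p₁ , q₂ - p₂

  cross : Point → Point → ℚ
  cross (u₁ , u₂) (v₁ , v₂) = u₁ * v₂ - u₂ * v₁

  -- Positive iff a, b, p make a left turn.
  orient : Point → Point → Point → ℚ
  orient a b p = cross (b ⊖ a) (p ⊖ a)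

  private
    :cross : ∀ {n} (u₁ u₂ v₁ v₂ : Polynomial n) → Polynomial n
    :cross u₁ u₂ v₁ v₂ = u₁ :* v₂ :- u₂ :* v₁

    :orient : ∀ {n} (a₁ a₂ b₁ b₂ p₁ p₂ : Polynomial n) → Polynomial n
    :orient a₁ a₂ b₁ b₂ p₁ p₂ = :cross (b₁ :- a₁) (b₂ :- a₂) (p₁ :- a₁) (p₂ :- a₂)

  0ᵥ : Point
  0ᵥ = 0ℚ , 0ℚ

  ≺⇒0≺⊖ : ∀ {p q} → p ≺ q → 0ᵥ ≺ q ⊖ p
  ≺⇒0≺⊖ (inj₁ lt) = inj₁ (p<q⇒0<q-p lt)
  ≺⇒0≺⊖ {p} (inj₂ (refl , lt)) = inj₂ (sym (+-inverseʳ (proj₁ p)) , p<q⇒0<q-p lt)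

  infixl 6 _⊕_
  _⊕_ : Point → Point → Point
  (u₁ , u₂) ⊕ (v₁ , v₂) = u₁ + v₁ , u₂ + v₂

  infixl 7 _·_
  _·_ : ℚ → Point → Point
  s · (u₁ , u₂) = s * u₁ , s * u₂

  ≺-·-pos : ∀ {s u} → 0ℚ < s → 0ᵥ ≺ u → 0ᵥ ≺ s · u
  ≺-·-pos 0<s (inj₁ lt) = inj₁ (*-pos 0<s lt)
  ≺-·-pos {s} 0<s (inj₂ (refl , lt)) = inj₂ (sym (*-zeroʳ s) , *-pos 0<s lt)

  ≺-⊕ : ∀ {u v} → 0ᵥ ≺ u → 0ᵥ ≺ v → 0ᵥ ≺ u ⊕ v
  ≺-⊕ (inj₁ a) (inj₁ b) = inj₁ (+-mono-< a b)
  ≺-⊕ (inj₁ a) (inj₂ (refl , b)) = inj₁ (+-mono-<-≤ a ≤-refl)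
  ≺-⊕ (inj₂ (refl , a)) (inj₁ b) = inj₁ (+-mono-≤-< ≤-refl b)
  ≺-⊕ (inj₂ (refl , a)) (inj₂ (refl , b)) = inj₂ (refl , +-mono-< a b)

  ≺-·-⊕ : ∀ {s u v} → 0ℚ ≤ s → 0ᵥ ≺ u → 0ᵥ ≺ v → 0ᵥ ≺ s · u ⊕ v
  ≺-·-⊕ {s} {u₁ , u₂} {v₁ , v₂} 0≤s 0≺u 0≺v with <-cmp 0ℚ s
  ... | tri< 0<s _ _ = ≺-⊕ {s · (u₁ , u₂)} (≺-·-pos {s} {u₁ , u₂} 0<s 0≺u) 0≺v
  ... | tri> _ _ s<0 = ⊥-elim (<-irrefl refl (<-≤-trans s<0 0≤s))
  ... | tri≈ _ refl _ = subst (0ᵥ ≺_) (cong₂ _,_ (0·+ u₁ v₁) (0·+ u₂ v₂)) 0≺v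
    where
    0·+ : ∀ x y → y ≡ 0ℚ * x + y
    0·+ x y = trans (sym (+-identityˡ y)) (cong (_+ y) (sym (*-zeroˡ x)))

  -- In the plane (v × w) u + (w × u) v + (u × v) w = 0.
  cross-cone : ∀ {u v w} → 0ᵥ ≺ u → 0ᵥ ≺ v → 0ᵥ ≺ w →
               0ℚ ≤ cross v w → 0ℚ ≤ cross w u → 0ℚ < cross u v → ⊥
  cross-cone {u₁ , u₂} {v₁ , v₂} {w₁ , w₂} 0≺u 0≺v 0≺w A B C =
    ≺-irrefl (refl , refl) (subst (0ᵥ ≺_) (cong₂ _,_
      (solve 6 (λ u₁ u₂ v₁ v₂ w₁ w₂ →
        :cross v₁ v₂ w₁ w₂ :* u₁ :+ (:cross w₁ w₂ u₁ u₂ :* v₁ :+ :cross u₁ u₂ v₁ v₂ :* w₁) := con 0ℚ)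
        refl u₁ u₂ v₁ v₂ w₁ w₂)
      (solve 6 (λ u₁ u₂ v₁ v₂ w₁ w₂ →
        :cross v₁ v₂ w₁ w₂ :* u₂ :+ (:cross w₁ w₂ u₁ u₂ :* v₂ :+ :cross u₁ u₂ v₁ v₂ :* w₂) := con 0ℚ)
        refl u₁ u₂ v₁ v₂ w₁ w₂))
      (≺-·-⊕ {cross v w} {u} A 0≺u (≺-·-⊕ {cross w u} {v} B 0≺v (≺-·-pos {cross u v} {w} C 0≺w))))
    where
    u = u₁ , u₂
    v = v₁ , v₂
    w = w₁ , w₂

  reciprocal : ∀ {d} → 0ℚ < d → ∃[ r ] 0ℚ < r × d * r ≡ 1ℚ
  reciprocal {d} 0<d = 1/ d , positive⁻¹ (1/ d) {{1/pos⇒pos d}} , *-inverseʳ d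
    where
    instance
      _ = positive 0<d
      _ = pos⇒nonZero d

  fraction-∈[] : ∀ {a b c d k} → 0ℚ < d → 0ℚ ≤ k → k ≤ d → d · (c ⊖ a) ≡ k · (b ⊖ a) → c ∈[ a , b ]
  fraction-∈[] {a₁ , a₂} {b₁ , b₂} {c₁ , c₂} {d} {k} 0<d 0≤k k≤d eq with reciprocal 0<d
  ... | r , 0<r , dr≡1 =
    k * r , *-nonNeg 0≤k (<⇒≤ 0<r) ,
    subst (k * r ≤_) dr≡1 (*-monoʳ-≤-nonNeg r {{nonNegative (<⇒≤ 0<r)}} k≤d) ,
    cong₂ _,_ (coordinate a₁ b₁ c₁ (cong proj₁ eq)) (coordinate a₂ b₂ c₂ (cong proj₂ eq))
    where
    open ≡-Reasoning
    coordinate : ∀ x y z → d * (z - x) ≡ k * (y - x) → z ≡ (1ℚ - k * r) * x + k * r * y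
    coordinate x y z eq = begin
      z
        ≡⟨ solve 2 (λ x z → z := x :+ con 1ℚ :* (z :- x)) refl x z ⟩
      x + 1ℚ * (z - x)
        ≡⟨ cong (λ s → x + s * (z - x)) dr≡1 ⟨
      x + d * r * (z - x)
        ≡⟨ solve 4 (λ d r x z → x :+ d :* r :* (z :- x) := x :+ r :* (d :* (z :- x))) refl d r x z ⟩
      x + r * (d * (z - x))
        ≡⟨ cong (λ s → x + r * s) eq ⟩
      x + r * (k * (y - x))
        ≡⟨ solve 4 (λ k r x y → x :+ r :* (k :* (y :- x)) := (con 1ℚ :- k :* r) :* x :+ k :* r :* y) refl k r x y ⟩
      (1ℚ - k * r) * x + k * r * y ∎

  interpolate-reverse : ∀ p q t → interpolate p q t ≡ interpolate q p (1ℚ - t)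
  interpolate-reverse (p₁ , p₂) (q₁ , q₂) t = cong₂ _,_ (coordinate p₁ q₁) (coordinate p₂ q₂)
    where
    coordinate : ∀ x y → (1ℚ - t) * x + t * y ≡ (1ℚ - (1ℚ - t)) * y + (1ℚ - t) * x
    coordinate x y = solve 3 (λ t x y →
      (con 1ℚ :- t) :* x :+ t :* y := (con 1ℚ :- (con 1ℚ :- t)) :* y :+ (con 1ℚ :- t) :* x) refl t x y

  ∈[]-reverse : ∀ {p q c} → c ∈[ p , q ] → c ∈[ q , p ]
  ∈[]-reverse {p} {q} (t , 0≤t , t≤1 , eq) =
    1ℚ - t , p≤q⇒0≤q-p t≤1 ,
    0≤q-p⇒p≤q (subst (0ℚ ≤_) (solve 1 (λ t → t := con 1ℚ :- (con 1ℚ :- t)) refl t) 0≤t) ,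
    trans eq (interpolate-reverse p q t)

  start-∈[] : ∀ p q → p ∈[ p , q ]
  start-∈[] (p₁ , p₂) (q₁ , q₂) = 0ℚ , ≤-refl , nonNegative⁻¹ 1ℚ , cong₂ _,_ (coordinate p₁ q₁) (coordinate p₂ q₂)
    where
    coordinate : ∀ x y → x ≡ (1ℚ - 0ℚ) * x + 0ℚ * y
    coordinate x y = solve 2 (λ x y → x := (con 1ℚ :- con 0ℚ) :* x :+ con 0ℚ :* y) refl x y

  end-∈[] : ∀ p q → q ∈[ p , q ]
  end-∈[] p q = ∈[]-reverse {q} {p} (start-∈[] q p)

  between-∈[] : ∀ {a b p} → a ≺ p → p ≺ b → orient a b p ≡ 0ℚ → p ∈[ a , b ]
  between-∈[] {a₁ , a₂} {b₁ , b₂} {p₁ , p₂} a≺p p≺b eq = go a≺p p≺b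
    where
    collinear : (b₁ - a₁) * (p₂ - a₂) ≡ (p₁ - a₁) * (b₂ - a₂)
    collinear = begin
      (b₁ - a₁) * (p₂ - a₂)
        ≡⟨ solve 4 (λ x y z w → x :* y := (x :* y :- z :* w) :+ w :* z) refl (b₁ - a₁) (p₂ - a₂) (b₂ - a₂) (p₁ - a₁) ⟩
      orient (a₁ , a₂) (b₁ , b₂) (p₁ , p₂) + (p₁ - a₁) * (b₂ - a₂)
        ≡⟨ cong (_+ (p₁ - a₁) * (b₂ - a₂)) eq ⟩
      0ℚ + (p₁ - a₁) * (b₂ - a₂)
        ≡⟨ +-identityˡ _ ⟩
      (p₁ - a₁) * (b₂ - a₂) ∎
      where open ≡-Reasoning
    swap : ∀ x y z → (x - z) * (y - z) ≡ (y - z) * (x - z)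
    swap x y z = *-comm (x - z) (y - z)
    horizontal : a₁ ≤ p₁ → p₁ ≤ b₁ → a₁ < b₁ → (p₁ , p₂) ∈[ (a₁ , a₂) , (b₁ , b₂) ]
    horizontal a≤p p≤b a<b = fraction-∈[] {k = p₁ - a₁} (p<q⇒0<q-p a<b) (p≤q⇒0≤q-p a≤p) (+-monoˡ-≤ (- a₁) p≤b)
      (cong₂ _,_ (swap b₁ p₁ a₁) collinear)
    go : (a₁ , a₂) ≺ (p₁ , p₂) → (p₁ , p₂) ≺ (b₁ , b₂) → (p₁ , p₂) ∈[ (a₁ , a₂) , (b₁ , b₂) ]
    go (inj₁ u) (inj₁ v) = horizontal (<⇒≤ u) (<⇒≤ v) (<-trans u v)
    go (inj₁ u) (inj₂ (refl , v)) = horizontal (<⇒≤ u) ≤-refl u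
    go (inj₂ (refl , u)) (inj₁ v) = horizontal ≤-refl (<⇒≤ v) v
    go (inj₂ (refl , u)) (inj₂ (refl , v)) =
      fraction-∈[] {k = p₂ - a₂} (p<q⇒0<q-p (<-trans u v)) (p≤q⇒0≤q-p (<⇒≤ u)) (+-monoˡ-≤ (- a₂) (<⇒≤ v))
        (cong₂ _,_ (solve 3 (λ x y z → x :* (z :- z) := y :* (z :- z)) refl (b₂ - a₂) (p₂ - a₂) a₁)
                   (swap b₂ p₂ a₂))

  Disjoint : Point → Point → Point → Point → Set
  Disjoint p q a b = ∀ c → c ∈[ p , q ] → c ∈[ a , b ] → ⊥

  opposite-sides-meet : ∀ {p q a b} → orient p q a < 0ℚ → 0ℚ < orient p q b →
                        0ℚ < orient a b p → orient a b q < 0ℚ → ¬ Disjoint p q a b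
  opposite-sides-meet {p₁ , p₂} {q₁ , q₂} {a₁ , a₂} {b₁ , b₂} a<0 0<b 0<p q<0 disjoint
    with reciprocal (p<q⇒0<q-p (<-trans a<0 0<b))
  ... | r , 0<r , dr≡1 = disjoint (interpolate p q (P * r))
    (P * r , *-nonNeg (<⇒≤ 0<p) (<⇒≤ 0<r) ,
      subst (P * r ≤_) dr≡1 (*-monoʳ-≤-nonNeg r {{nonNegative (<⇒≤ 0<r)}} P≤d) , refl)
    (fraction-∈[] {k = - A} (p<q⇒0<q-p (<-trans a<0 0<b)) (<⇒≤ (neg-antimono-< a<0)) -A≤d (cong₂ _,_ first second))
    where
    p = p₁ , p₂
    q = q₁ , q₂
    a = a₁ , a₂
    b = b₁ , b₂
    A = orient p q a
    B = orient p q b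
    P = orient a b p
    Q = orient a b q
    d = B - A
    P-Q≡d : P - Q ≡ d
    P-Q≡d = solve 8 (λ p₁ p₂ q₁ q₂ a₁ a₂ b₁ b₂ →
      :orient a₁ a₂ b₁ b₂ p₁ p₂ :- :orient a₁ a₂ b₁ b₂ q₁ q₂
      := :orient p₁ p₂ q₁ q₂ b₁ b₂ :- :orient p₁ p₂ q₁ q₂ a₁ a₂)
      refl p₁ p₂ q₁ q₂ a₁ a₂ b₁ b₂
    P≤d : P ≤ d
    P≤d = subst₂ _≤_ (+-identityʳ P) P-Q≡d (+-monoʳ-≤ P (<⇒≤ (neg-antimono-< q<0)))
    -A≤d : - A ≤ d
    -A≤d = subst (_≤ d) (+-identityˡ (- A)) (+-monoˡ-≤ (- A) (<⇒≤ 0<b))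
    unscale : ∀ x y z → d * (((1ℚ - P * r) * x + P * r * y) - z) ≡ d * (x - z) + P * (y - x)
    unscale x y z = trans
      (solve 6 (λ d P r x y z →
        d :* (((con 1ℚ :- P :* r) :* x :+ P :* r :* y) :- z) := d :* (x :- z) :+ (d :* r) :* (P :* (y :- x)))
        refl d P r x y z)
      (cong (d * (x - z) +_) (trans (cong (_* (P * (y - x))) dr≡1) (*-identityˡ _)))
    first : d * (((1ℚ - P * r) * p₁ + P * r * q₁) - a₁) ≡ - A * (b₁ - a₁)
    first = trans (unscale p₁ q₁ a₁) (solve 8 (λ p₁ p₂ q₁ q₂ a₁ a₂ b₁ b₂ →
      (:orient p₁ p₂ q₁ q₂ b₁ b₂ :- :orient p₁ p₂ q₁ q₂ a₁ a₂) :* (p₁ :- a₁)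
        :+ :orient a₁ a₂ b₁ b₂ p₁ p₂ :* (q₁ :- p₁)
      := :- :orient p₁ p₂ q₁ q₂ a₁ a₂ :* (b₁ :- a₁))
      refl p₁ p₂ q₁ q₂ a₁ a₂ b₁ b₂)
    second : d * (((1ℚ - P * r) * p₂ + P * r * q₂) - a₂) ≡ - A * (b₂ - a₂)
    second = trans (unscale p₂ q₂ a₂) (solve 8 (λ p₁ p₂ q₁ q₂ a₁ a₂ b₁ b₂ →
      (:orient p₁ p₂ q₁ q₂ b₁ b₂ :- :orient p₁ p₂ q₁ q₂ a₁ a₂) :* (p₂ :- a₂)
        :+ :orient a₁ a₂ b₁ b₂ p₁ p₂ :* (q₂ :- p₂)
      := :- :orient p₁ p₂ q₁ q₂ a₁ a₂ :* (b₂ :- a₂))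
      refl p₁ p₂ q₁ q₂ a₁ a₂ b₁ b₂)

  cross-antisym : ∀ u v → cross u v ≡ - cross v u
  cross-antisym (u₁ , u₂) (v₁ , v₂) =
    solve 4 (λ u₁ u₂ v₁ v₂ → :cross u₁ u₂ v₁ v₂ := :- :cross v₁ v₂ u₁ u₂) refl u₁ u₂ v₁ v₂

  orient-cycle : ∀ a b p → orient a b p ≡ orient b p a
  orient-cycle (a₁ , a₂) (b₁ , b₂) (p₁ , p₂) =
    solve 6 (λ a₁ a₂ b₁ b₂ p₁ p₂ → :orient a₁ a₂ b₁ b₂ p₁ p₂ := :orient b₁ b₂ p₁ p₂ a₁ a₂)
      refl a₁ a₂ b₁ b₂ p₁ p₂

  cross-steps : ∀ a b c → cross (b ⊖ a) (c ⊖ b) ≡ orient a b c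
  cross-steps (a₁ , a₂) (b₁ , b₂) (c₁ , c₂) =
    solve 6 (λ a₁ a₂ b₁ b₂ c₁ c₂ → :cross (b₁ :- a₁) (b₂ :- a₂) (c₁ :- b₁) (c₂ :- b₂) := :orient a₁ a₂ b₁ b₂ c₁ c₂)
      refl a₁ a₂ b₁ b₂ c₁ c₂

  orient-via-start : ∀ p a b q → orient p q a ≡ cross (q ⊖ b) (a ⊖ p) - cross (a ⊖ p) (b ⊖ a)
  orient-via-start (p₁ , p₂) (a₁ , a₂) (b₁ , b₂) (q₁ , q₂) =
    solve 8 (λ p₁ p₂ a₁ a₂ b₁ b₂ q₁ q₂ → :orient p₁ p₂ q₁ q₂ a₁ a₂ :=
      :cross (q₁ :- b₁) (q₂ :- b₂) (a₁ :- p₁) (a₂ :- p₂) :- :cross (a₁ :- p₁) (a₂ :- p₂) (b₁ :- a₁) (b₂ :- a₂))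
      refl p₁ p₂ a₁ a₂ b₁ b₂ q₁ q₂

  orient-via-end : ∀ p a b q → orient p q b ≡ cross (q ⊖ b) (a ⊖ p) - cross (b ⊖ a) (q ⊖ b)
  orient-via-end (p₁ , p₂) (a₁ , a₂) (b₁ , b₂) (q₁ , q₂) =
    solve 8 (λ p₁ p₂ a₁ a₂ b₁ b₂ q₁ q₂ → :orient p₁ p₂ q₁ q₂ b₁ b₂ :=
      :cross (q₁ :- b₁) (q₂ :- b₂) (a₁ :- p₁) (a₂ :- p₂) :- :cross (b₁ :- a₁) (b₂ :- a₂) (q₁ :- b₁) (q₂ :- b₂))
      refl p₁ p₂ a₁ a₂ b₁ b₂ q₁ q₂

  cross-steps′ : ∀ a b c → cross (c ⊖ a) (c ⊖ b) ≡ orient a b c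
  cross-steps′ (a₁ , a₂) (b₁ , b₂) (c₁ , c₂) =
    solve 6 (λ a₁ a₂ b₁ b₂ c₁ c₂ → :cross (c₁ :- a₁) (c₂ :- a₂) (c₁ :- b₁) (c₂ :- b₂) := :orient a₁ a₂ b₁ b₂ c₁ c₂)
      refl a₁ a₂ b₁ b₂ c₁ c₂

  cross-flip-neg : ∀ u v → cross u v < 0ℚ → 0ℚ < cross v u
  cross-flip-neg u v lt = subst (0ℚ <_) (sym (cross-antisym v u)) (neg-antimono-< lt)

  cross-flip-nonPos : ∀ u v → cross u v ≤ 0ℚ → 0ℚ ≤ cross v u
  cross-flip-nonPos u v le = subst (0ℚ ≤_) (sym (cross-antisym v u)) (neg-antimono-≤ le)

  cross-cone⁻ : ∀ {u v w} → 0ᵥ ≺ u → 0ᵥ ≺ v → 0ᵥ ≺ w →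
                cross v w < 0ℚ → cross w u ≤ 0ℚ → cross u v ≤ 0ℚ → ⊥
  cross-cone⁻ {u} {v} {w} 0≺u 0≺v 0≺w A B C = cross-cone 0≺w 0≺v 0≺u
    (cross-flip-nonPos u v C) (cross-flip-nonPos w u B) (cross-flip-neg v w A)

  cross-cyclic⁺ : ∀ {u v w} → 0ᵥ ≺ u → 0ᵥ ≺ v → 0ᵥ ≺ w →
                  0ℚ < cross u v → 0ℚ < cross v w → 0ℚ < cross u w
  cross-cyclic⁺ {u} {v} {w} 0≺u 0≺v 0≺w uv vw = ≰⇒> λ uw →
    cross-cone 0≺u 0≺v 0≺w (<⇒≤ vw) (cross-flip-nonPos u w uw) uv

  cross-cyclic⁻ : ∀ {u v w} → 0ᵥ ≺ u → 0ᵥ ≺ v → 0ᵥ ≺ w →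
                  cross u v < 0ℚ → cross v w < 0ℚ → cross u w < 0ℚ
  cross-cyclic⁻ {u} {v} {w} 0≺u 0≺v 0≺w uv vw = ≰⇒> λ uw →
    cross-cone⁻ 0≺u 0≺v 0≺w vw (subst (_≤ 0ℚ) (sym (cross-antisym w u)) (neg-antimono-≤ uw)) (<⇒≤ uv)

  module _ {a b c d} (a≺b : a ≺ b) (b≺c : b ≺ c) (c≺d : c ≺ d) where
    private
      a≺c = ≺-trans {a} a≺b b≺c
      b≺d = ≺-trans {b} b≺c c≺d

    left-turns : 0ℚ < orient a b c → 0ℚ < orient b c d → 0ℚ < orient a b d × 0ℚ < orient a c d
    left-turns abc bcd =
      subst (0ℚ <_) (cross-steps a b d)
        (cross-cyclic⁺ (≺⇒0≺⊖ {a} a≺b) (≺⇒0≺⊖ {b} b≺c) (≺⇒0≺⊖ {b} b≺d)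
          (subst (0ℚ <_) (sym (cross-steps a b c)) abc) bcd) ,
      subst (0ℚ <_) (cross-steps a c d)
        (cross-cyclic⁺ (≺⇒0≺⊖ {a} a≺c) (≺⇒0≺⊖ {b} b≺c) (≺⇒0≺⊖ {c} c≺d)
          (subst (0ℚ <_) (sym (cross-steps′ a b c)) abc) (subst (0ℚ <_) (sym (cross-steps b c d)) bcd))

    right-turns : orient a b c < 0ℚ → orient b c d < 0ℚ → orient a b d < 0ℚ × orient a c d < 0ℚ
    right-turns abc bcd =
      subst (_< 0ℚ) (cross-steps a b d)
        (cross-cyclic⁻ (≺⇒0≺⊖ {a} a≺b) (≺⇒0≺⊖ {b} b≺c) (≺⇒0≺⊖ {b} b≺d)
          (subst (_< 0ℚ) (sym (cross-steps a b c)) abc) bcd) ,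
      subst (_< 0ℚ) (cross-steps a c d)
        (cross-cyclic⁻ (≺⇒0≺⊖ {a} a≺c) (≺⇒0≺⊖ {b} b≺c) (≺⇒0≺⊖ {c} c≺d)
          (subst (_< 0ℚ) (sym (cross-steps′ a b c)) abc) (subst (_< 0ℚ) (sym (cross-steps b c d)) bcd))

  disjoint-sym : ∀ {p q a b} → Disjoint p q a b → Disjoint a b p q
  disjoint-sym disjoint c u v = disjoint c v u

  opaque
    isBelow : Point → Point → Point → Bool
    isBelow p a b = does (orient a b p <? 0ℚ)

    isBelow-true : ∀ {p a b} → orient a b p < 0ℚ → isBelow p a b ≡ true
    isBelow-true = dec-true (_ <? _)

    isBelow-false : ∀ {p a b} → ¬ orient a b p < 0ℚ → isBelow p a b ≡ false
    isBelow-false = dec-false (_ <? _)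

  data Side (p a b : Point) : Set where
    below : orient a b p < 0ℚ → isBelow p a b ≡ true → Side p a b
    above : 0ℚ < orient a b p → isBelow p a b ≡ false → Side p a b

  side : ∀ {p a b} → a ≺ p → p ≺ b → ¬ p ∈[ a , b ] → Side p a b
  side {p} {a} {b} a≺p p≺b p∉ with <-cmp (orient a b p) 0ℚ
  ... | tri< lt _ _ = below lt (isBelow-true {p} {a} {b} lt)
  ... | tri≈ _ eq _ = ⊥-elim (p∉ (between-∈[] {a} {b} a≺p p≺b eq))
  ... | tri> ≮ _ gt = above gt (isBelow-false {p} {a} {b} ≮)

  interleaved-sides : ∀ {p q a b} → p ≺ a → a ≺ q → q ≺ b → Disjoint p q a b →
                      isBelow q a b xor isBelow a p q ≡ true
  interleaved-sides {p} {q} {a} {b} p≺a a≺q q≺b disjoint =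
    compare (side {q} {a} {b} a≺q q≺b (disjoint q (end-∈[] p q)))
            (side {a} {p} {q} p≺a a≺q (λ a∈ → disjoint a a∈ (start-∈[] a b)))
    where
    cross-flip-pos : ∀ u v → 0ℚ < cross u v → cross v u < 0ℚ
    cross-flip-pos u v gt = subst (_< 0ℚ) (sym (cross-antisym v u)) (neg-antimono-< gt)
    compare : Side q a b → Side a p q → isBelow q a b xor isBelow a p q ≡ true
    compare (below _ e) (above _ f) = cong₂ _xor_ e f
    compare (above _ e) (below _ f) = cong₂ _xor_ e f
    compare (below q<0 _) (below a<0 _) =
      let pab , pqb = left-turns {p} {a} {q} {b} p≺a a≺q q≺b
                        (cross-flip-neg (q ⊖ p) (a ⊖ p) a<0) (cross-flip-neg (b ⊖ a) (q ⊖ a) q<0)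
      in ⊥-elim (opposite-sides-meet a<0 pqb (subst (0ℚ <_) (orient-cycle p a b) pab) q<0 disjoint)
    compare (above 0<q _) (above 0<a _) =
      let pab , pqb = right-turns {p} {a} {q} {b} p≺a a≺q q≺b
                        (cross-flip-pos (q ⊖ p) (a ⊖ p) 0<a) (cross-flip-pos (b ⊖ a) (q ⊖ a) 0<q)
      in ⊥-elim (opposite-sides-meet (subst (_< 0ℚ) (orient-cycle p a b) pab) 0<q 0<a pqb
           (disjoint-sym {p} {q} {a} {b} disjoint))

  nested-sides : ∀ {p q a b} → p ≺ a → a ≺ b → b ≺ q → Disjoint p q a b →
                 isBelow a p q xor isBelow b p q ≡ false
  nested-sides {p} {q} {a} {b} p≺a a≺b b≺q disjoint =
    compare (side {a} {p} {q} p≺a (≺-trans {a} a≺b b≺q) (λ a∈ → disjoint a a∈ (start-∈[] a b)))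
            (side {b} {p} {q} (≺-trans {p} p≺a a≺b) b≺q (λ b∈ → disjoint b b∈ (end-∈[] a b)))
    where
    u = ≺⇒0≺⊖ {p} p≺a
    v = ≺⇒0≺⊖ {a} a≺b
    w = ≺⇒0≺⊖ {b} b≺q
    A = cross (b ⊖ a) (q ⊖ b)
    B = cross (q ⊖ b) (a ⊖ p)
    C = cross (a ⊖ p) (b ⊖ a)
    C≡ : C ≡ orient a b p
    C≡ = trans (cross-steps p a b) (orient-cycle p a b)
    A≡ : A ≡ orient a b q
    A≡ = cross-steps a b q
    compare : Side a p q → Side b p q → isBelow a p q xor isBelow b p q ≡ false
    compare (below _ e) (below _ f) = cong₂ _xor_ e f
    compare (above _ e) (above _ f) = cong₂ _xor_ e f
    compare (below a<0 _) (above 0<b _) = ⊥-elim (opposite-sides-meet a<0 0<b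
      (subst (0ℚ <_) C≡ (≰⇒> λ C≤0 →
        let B<0 = <-≤-trans B<C C≤0 in cross-cone⁻ u v w (<-trans A<B B<0) (<⇒≤ B<0) C≤0))
      (subst (_< 0ℚ) A≡ (≰⇒> λ 0≤A →
        let 0<B = ≤-<-trans 0≤A A<B in cross-cone u v w 0≤A (<⇒≤ 0<B) (<-trans 0<B B<C)))
      disjoint)
      where
      B<C : B < C
      B<C = p-q<0⇒p<q (subst (_< 0ℚ) (orient-via-start p a b q) a<0)
      A<B : A < B
      A<B = 0<p-q⇒q<p (subst (0ℚ <_) (orient-via-end p a b q) 0<b)
    compare (above 0<a _) (below b<0 _) = ⊥-elim (opposite-sides-meet
      (subst (_< 0ℚ) C≡ (≰⇒> λ 0≤C →
        let 0<B = ≤-<-trans 0≤C C<B in cross-cone v w u (<⇒≤ 0<B) 0≤C (<-trans 0<B B<A)))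
      (subst (0ℚ <_) A≡ (≰⇒> λ A≤0 →
        let B<0 = <-≤-trans B<A A≤0 in cross-cone⁻ w u v (<-trans C<B B<0) A≤0 (<⇒≤ B<0)))
      0<a b<0 (disjoint-sym {p} {q} {a} {b} disjoint))
      where
      C<B : C < B
      C<B = 0<p-q⇒q<p (subst (0ℚ <_) (orient-via-start p a b q) 0<a)
      B<A : B < A
      B<A = p-q<0⇒p<q (subst (_< 0ℚ) (orient-via-end p a b q) b<0)

-- Crossing parity

opaque
  before : Point → Point → Bool
  before p a = does (p ≺? a)

  before-true : ∀ {p a} → p ≺ a → before p a ≡ true
  before-true {p} {a} = dec-true (p ≺? a)

  before-false : ∀ {p a} → a ≺ p → before p a ≡ false
  before-false {p} {a} a≺p = dec-false (p ≺? a) (≺-asym {a} {p} a≺p)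

  before-irrefl : ∀ p → before p p ≡ false
  before-irrefl p = dec-false (p ≺? p) (≺-irrefl {p} (refl , refl))

before-not : ∀ {p a} → p ≢ a → before p a ≡ true xor before a p
before-not {p} {a} p≢a with ≺-cmp p a
... | tri< p≺a _ _ = trans (before-true {p} {a} p≺a) (sym (cong not (before-false {a} {p} p≺a)))
... | tri> _ _ a≺p = trans (before-false {p} {a} a≺p) (sym (cong not (before-true {a} {p} a≺p)))
... | tri≈ _ (refl , refl) _ = ⊥-elim (p≢a refl)

-- Whether the vertical ray going up from p crosses the segment from a to b.  As
-- "between" refers to the lexicographic order, the ray is tilted infinitesimally
-- and never passes through an end of a segment that avoids p.
under : Point → Point → Point → Bool
under p a b = (before a p ∧ before p b ∧ isBelow p a b) ∨ (before b p ∧ before p a ∧ isBelow p b a)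

under-between : ∀ {p a b} → a ≺ p → p ≺ b → under p a b ≡ isBelow p a b
under-between {p} {a} {b} a≺p p≺b
  rewrite before-true {a} {p} a≺p | before-true {p} {b} p≺b | before-false {b} {p} p≺b = ∨-identityʳ _

under-left : ∀ {p a b} → p ≺ a → p ≺ b → under p a b ≡ false
under-left {p} {a} {b} p≺a p≺b
  rewrite before-false {a} {p} p≺a | before-false {b} {p} p≺b = refl

under-right : ∀ {p a b} → a ≺ p → b ≺ p → under p a b ≡ false
under-right {p} {a} {b} a≺p b≺p
  rewrite before-false {p} {b} b≺p | before-false {p} {a} a≺p =
    cong₂ _∨_ (∧-zeroʳ (before a p)) (∧-zeroʳ (before b p))

under-swap : ∀ p a b → under p a b ≡ under p b a
under-swap p a b = ∨-comm (before a p ∧ before p b ∧ isBelow p a b) _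

under-degenerate : ∀ p a → under p a a ≡ false
under-degenerate p a with ≺-cmp p a
... | tri< p≺a _ _ = under-left {p} {a} {a} p≺a p≺a
... | tri> _ _ a≺p = under-right {p} {a} {a} a≺p a≺p
... | tri≈ _ (refl , refl) _ rewrite before-irrefl p = refl

xor-false : ∀ {x y} → x ≡ false → y ≡ false → x xor y ≡ false
xor-false refl refl = refl

module _ where
  open xor-∧-Solver

  :Σ₈ : ∀ {n} → (x₁ x₂ x₃ x₄ x₅ x₆ x₇ x₈ : Polynomial n) → Polynomial n
  :Σ₈ x₁ x₂ x₃ x₄ x₅ x₆ x₇ x₈ = (x₁ :+ x₂) :+ ((x₃ :+ x₄) :+ ((x₅ :+ x₆) :+ (x₇ :+ x₈)))

  -- The arguments of Σ₈ will always be, in this order: for paths A from p to q and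
  -- B from a to b, whether p and q are under B, whether a and b are under A (all
  -- mod 2), and the values of before at (p , a), (q , a), (p , b) and (q , b).
  opaque
    Σ₈ : (x₁ x₂ x₃ x₄ x₅ x₆ x₇ x₈ : Bool) → Bool
    Σ₈ x₁ x₂ x₃ x₄ x₅ x₆ x₇ x₈ = (x₁ xor x₂) xor ((x₃ xor x₄) xor ((x₅ xor x₆) xor (x₇ xor x₈)))

    Σ₈-exchange : ∀ {x₁ x₂ x₃ x₄ x₅ x₆ x₇ x₈} →
      Σ₈ x₁ x₂ x₃ x₄ x₅ x₆ x₇ x₈ ≡ Σ₈ x₃ x₄ x₁ x₂ x₅ x₇ x₆ x₈
    Σ₈-exchange {x₁} {x₂} {x₃} {x₄} {x₅} {x₆} {x₇} {x₈} =
      solve 8 (λ x₁ x₂ x₃ x₄ x₅ x₆ x₇ x₈ → :Σ₈ x₁ x₂ x₃ x₄ x₅ x₆ x₇ x₈ := :Σ₈ x₃ x₄ x₁ x₂ x₅ x₇ x₆ x₈)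
        refl x₁ x₂ x₃ x₄ x₅ x₆ x₇ x₈

    Σ₈-reverse₁ : ∀ {x₁ x₂ x₃ x₄ x₅ x₆ x₇ x₈} →
      Σ₈ x₁ x₂ x₃ x₄ x₅ x₆ x₇ x₈ ≡ Σ₈ x₂ x₁ x₃ x₄ x₆ x₅ x₈ x₇
    Σ₈-reverse₁ {x₁} {x₂} {x₃} {x₄} {x₅} {x₆} {x₇} {x₈} =
      solve 8 (λ x₁ x₂ x₃ x₄ x₅ x₆ x₇ x₈ → :Σ₈ x₁ x₂ x₃ x₄ x₅ x₆ x₇ x₈ := :Σ₈ x₂ x₁ x₃ x₄ x₆ x₅ x₈ x₇)
        refl x₁ x₂ x₃ x₄ x₅ x₆ x₇ x₈

    Σ₈-reverse₂ : ∀ {x₁ x₂ x₃ x₄ x₅ x₆ x₇ x₈} →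
      Σ₈ x₁ x₂ x₃ x₄ x₅ x₆ x₇ x₈ ≡ Σ₈ x₁ x₂ x₄ x₃ x₇ x₈ x₅ x₆
    Σ₈-reverse₂ {x₁} {x₂} {x₃} {x₄} {x₅} {x₆} {x₇} {x₈} =
      solve 8 (λ x₁ x₂ x₃ x₄ x₅ x₆ x₇ x₈ → :Σ₈ x₁ x₂ x₃ x₄ x₅ x₆ x₇ x₈ := :Σ₈ x₁ x₂ x₄ x₃ x₇ x₈ x₅ x₆)
        refl x₁ x₂ x₃ x₄ x₅ x₆ x₇ x₈

    Σ₈-not : ∀ {x₁ x₂ x₃ x₄ x₅ x₆ x₇ x₈} →
      Σ₈ x₁ x₂ x₃ x₄ (true xor x₅) (true xor x₆) (true xor x₇) (true xor x₈) ≡ Σ₈ x₁ x₂ x₃ x₄ x₅ x₆ x₇ x₈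
    Σ₈-not {x₁} {x₂} {x₃} {x₄} {x₅} {x₆} {x₇} {x₈} =
      solve 8 (λ x₁ x₂ x₃ x₄ x₅ x₆ x₇ x₈ →
        :Σ₈ x₁ x₂ x₃ x₄ (con true :+ x₅) (con true :+ x₆) (con true :+ x₇) (con true :+ x₈) :=
        :Σ₈ x₁ x₂ x₃ x₄ x₅ x₆ x₇ x₈)
        refl x₁ x₂ x₃ x₄ x₅ x₆ x₇ x₈

    Σ₈-point : ∀ {x y z} → Σ₈ x x false false y y z z ≡ false
    Σ₈-point {x} {y} {z} =
      solve 3 (λ x y z → :Σ₈ x x (con false) (con false) y y z z := con false) refl x y z

    Σ₈-split : ∀ {x₁ x₂ x₃ x₅ x₆ y₁ y₂ z₄ z₇ z₈} m₄ m₇ m₈ →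
      Σ₈ (x₁ xor y₁) (x₂ xor y₂) x₃ z₄ x₅ x₆ z₇ z₈ ≡
      Σ₈ x₁ x₂ x₃ m₄ x₅ x₆ m₇ m₈ xor Σ₈ y₁ y₂ m₄ z₄ m₇ m₈ z₇ z₈
    Σ₈-split {x₁} {x₂} {x₃} {x₅} {x₆} {y₁} {y₂} {z₄} {z₇} {z₈} m₄ m₇ m₈ =
      solve 13 (λ x₁ x₂ x₃ x₅ x₆ y₁ y₂ z₄ z₇ z₈ m₄ m₇ m₈ →
        :Σ₈ (x₁ :+ y₁) (x₂ :+ y₂) x₃ z₄ x₅ x₆ z₇ z₈ :=
        :Σ₈ x₁ x₂ x₃ m₄ x₅ x₆ m₇ m₈ :+ :Σ₈ y₁ y₂ m₄ z₄ m₇ m₈ z₇ z₈)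
        refl x₁ x₂ x₃ x₅ x₆ y₁ y₂ z₄ z₇ z₈ m₄ m₇ m₈

    Σ₈-isolate : ∀ {x₁ x₂ x₃ x₄ x₅ x₆ x₇ x₈} → Σ₈ x₁ x₂ x₃ x₄ x₅ x₆ x₇ x₈ ≡ false →
      x₄ xor x₂ ≡ ((x₃ xor x₆) xor (x₁ xor x₅ xor x₇)) xor x₈
    Σ₈-isolate {x₁} {x₂} {x₃} {x₄} {x₅} {x₆} {x₇} {x₈} Σ≡false = trans
      (solve 8 (λ x₁ x₂ x₃ x₄ x₅ x₆ x₇ x₈ → x₄ :+ x₂ :=
        :Σ₈ x₁ x₂ x₃ x₄ x₅ x₆ x₇ x₈ :+ (((x₃ :+ x₆) :+ (x₁ :+ (x₅ :+ x₇))) :+ x₈))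
        refl x₁ x₂ x₃ x₄ x₅ x₆ x₇ x₈)
      (cong (_xor (((x₃ xor x₆) xor (x₁ xor x₅ xor x₇)) xor x₈)) Σ≡false)

    Σ₈-apart : Σ₈ false false false false true true true true ≡ false
    Σ₈-apart = refl

    Σ₈-interleaved : ∀ {x y} → x xor y ≡ true → Σ₈ false x y false true false true true ≡ false
    Σ₈-interleaved {true} {false} _ = refl
    Σ₈-interleaved {false} {true} _ = refl

    Σ₈-nested : ∀ {x y} → x xor y ≡ false → Σ₈ false false x y true false true false ≡ false
    Σ₈-nested {true} {true} _ = refl
    Σ₈-nested {false} {false} _ = refl

Σ₈-cong : ∀ {x₁ x₂ x₃ x₄ x₅ x₆ x₇ x₈ y₁ y₂ y₃ y₄ y₅ y₆ y₇ y₈} →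
  x₁ ≡ y₁ → x₂ ≡ y₂ → x₃ ≡ y₃ → x₄ ≡ y₄ → x₅ ≡ y₅ → x₆ ≡ y₆ → x₇ ≡ y₇ → x₈ ≡ y₈ →
  Σ₈ x₁ x₂ x₃ x₄ x₅ x₆ x₇ x₈ ≡ Σ₈ y₁ y₂ y₃ y₄ y₅ y₆ y₇ y₈
Σ₈-cong refl refl refl refl refl refl refl refl = refl

SegmentParity : Point → Point → Point → Point → Set
SegmentParity p q a b = Σ₈ (under p a b) (under q a b) (under a p q) (under b p q)
  (before p a) (before q a) (before p b) (before q b) ≡ false

segmentParity-reverse₁ : ∀ {p q a b} → SegmentParity q p a b → SegmentParity p q a b
segmentParity-reverse₁ {p} {q} {a} {b} parity = trans Σ₈-reverse₁
  (trans (Σ₈-cong refl refl (under-swap a p q) (under-swap b p q) refl refl refl refl) parity)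

segmentParity-reverse₂ : ∀ {p q a b} → SegmentParity p q b a → SegmentParity p q a b
segmentParity-reverse₂ {p} {q} {a} {b} parity = trans Σ₈-reverse₂
  (trans (Σ₈-cong (under-swap p a b) (under-swap q a b) refl refl refl refl refl refl) parity)

segment-parity-first : ∀ {p q a b} → p ≺ q → a ≺ b → p ≺ a → Disjoint p q a b → SegmentParity p q a b
segment-parity-first {p} {q} {a} {b} p≺q a≺b p≺a disjoint = position (≺-cmp q a) (≺-cmp q b)
  where
  p≺b = ≺-trans {p} {a} {b} p≺a a≺b
  position : Tri (q ≺ a) (q ≈ a) (a ≺ q) → Tri (q ≺ b) (q ≈ b) (b ≺ q) → SegmentParity p q a b
  position (tri< q≺a _ _) _ = trans
    (Σ₈-cong (under-left {p} {a} {b} p≺a p≺b) (under-left {q} {a} {b} q≺a q≺b)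
             (under-right {a} {p} {q} p≺a q≺a) (under-right {b} {p} {q} p≺b q≺b)
             (before-true {p} {a} p≺a) (before-true {q} {a} q≺a) (before-true {p} {b} p≺b) (before-true {q} {b} q≺b))
    Σ₈-apart
    where q≺b = ≺-trans {q} {a} {b} q≺a a≺b
  position (tri> _ _ a≺q) (tri< q≺b _ _) = trans
    (Σ₈-cong (under-left {p} {a} {b} p≺a p≺b) (under-between {q} {a} {b} a≺q q≺b)
             (under-between {a} {p} {q} p≺a a≺q) (under-right {b} {p} {q} p≺b q≺b)
             (before-true {p} {a} p≺a) (before-false {q} {a} a≺q) (before-true {p} {b} p≺b) (before-true {q} {b} q≺b))
    (Σ₈-interleaved (interleaved-sides {p} {q} {a} {b} p≺a a≺q q≺b disjoint))
  position (tri> _ _ a≺q) (tri> _ _ b≺q) = trans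
    (Σ₈-cong (under-left {p} {a} {b} p≺a p≺b) (under-right {q} {a} {b} a≺q b≺q)
             (under-between {a} {p} {q} p≺a a≺q) (under-between {b} {p} {q} p≺b b≺q)
             (before-true {p} {a} p≺a) (before-false {q} {a} a≺q) (before-true {p} {b} p≺b) (before-false {q} {b} b≺q))
    (Σ₈-nested (nested-sides {p} {q} {a} {b} p≺a a≺b b≺q disjoint))
  position (tri≈ _ (refl , refl) _) _ = ⊥-elim (disjoint q (end-∈[] p q) (start-∈[] a b))
  position _ (tri≈ _ (refl , refl) _) = ⊥-elim (disjoint q (end-∈[] p q) (end-∈[] a b))

segment-parity-increasing : ∀ {p q a b} → p ≺ q → a ≺ b → Disjoint p q a b → SegmentParity p q a b
segment-parity-increasing {p} {q} {a} {b} p≺q a≺b disjoint with ≺-cmp p a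
... | tri< p≺a _ _ = segment-parity-first {p} {q} {a} {b} p≺q a≺b p≺a disjoint
... | tri≈ _ (refl , refl) _ = ⊥-elim (disjoint p (start-∈[] p q) (start-∈[] a b))
... | tri> _ _ a≺p = trans
  (Σ₈-cong refl refl refl refl (before-not (apart p∈ a∈)) (before-not (apart q∈ a∈))
                               (before-not (apart p∈ b∈)) (before-not (apart q∈ b∈)))
  (trans Σ₈-not (trans Σ₈-exchange
    (segment-parity-first {a} {b} {p} {q} a≺b p≺q a≺p (disjoint-sym {p} {q} {a} {b} disjoint))))
  where
  p∈ = start-∈[] p q
  q∈ = end-∈[] p q
  a∈ = start-∈[] a b
  b∈ = end-∈[] a b
  apart : ∀ {x y} → x ∈[ p , q ] → y ∈[ a , b ] → x ≢ y
  apart x∈ y∈ refl = disjoint _ x∈ y∈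

segment-parity-increasing₁ : ∀ {p q a b} → p ≺ q → Disjoint p q a b → SegmentParity p q a b
segment-parity-increasing₁ {p} {q} {a} {b} p≺q disjoint with ≺-cmp a b
... | tri< a≺b _ _ = segment-parity-increasing {p} {q} {a} {b} p≺q a≺b disjoint
... | tri≈ _ (refl , refl) _ = trans Σ₈-exchange
  (trans (Σ₈-cong refl refl (under-degenerate p a) (under-degenerate q a) refl refl refl refl) Σ₈-point)
... | tri> _ _ b≺a = segmentParity-reverse₂ {p} {q} {a} {b}
  (segment-parity-increasing {p} {q} {b} {a} p≺q b≺a (λ c c∈ c∈′ → disjoint c c∈ (∈[]-reverse {b} {a} c∈′)))

segment-parity : ∀ {p q a b} → Disjoint p q a b → SegmentParity p q a b
segment-parity {p} {q} {a} {b} disjoint with ≺-cmp p q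
... | tri< p≺q _ _ = segment-parity-increasing₁ {p} {q} {a} {b} p≺q disjoint
... | tri≈ _ (refl , refl) _ =
  trans (Σ₈-cong refl refl (under-degenerate a p) (under-degenerate b p) refl refl refl refl) Σ₈-point
... | tri> _ _ q≺p = segmentParity-reverse₁ {p} {q} {a} {b}
  (segment-parity-increasing₁ {q} {p} {a} {b} q≺p (λ c c∈ c∈′ → disjoint c (∈[]-reverse {q} {p} c∈) c∈′))

pathUnder : Point → List Point → Bool
pathUnder p (a ∷ b ∷ bs) = under p a b xor pathUnder p (b ∷ bs)
pathUnder p _ = false

endOf : Point → List Point → Point
endOf p [] = p
endOf p (q ∷ qs) = endOf q qs

endOf-++ : ∀ p qs q → endOf p (qs ++ [ q ]) ≡ q
endOf-++ p [] q = refl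
endOf-++ p (r ∷ qs) q = endOf-++ r qs q

PathParity : Point → Point → List Point → Point → Point → List Point → Set
PathParity p q A a b B = Σ₈ (pathUnder p B) (pathUnder q B) (pathUnder a A) (pathUnder b A)
  (before p a) (before q a) (before p b) (before q b) ≡ false

DisjointPaths : List Point → List Point → Set
DisjointPaths A B = ∀ c → c ∈ₚ A → c ∈ₚ B → ⊥

segment-path-parity : ∀ p q a as → (∀ c → c ∈[ p , q ] → c ∈ₚ a ∷ as → ⊥) →
  Σ₈ (pathUnder p (a ∷ as)) (pathUnder q (a ∷ as)) (under a p q) (under (endOf a as) p q)
     (before p a) (before q a) (before p (endOf a as)) (before q (endOf a as)) ≡ false
segment-path-parity p q a [] disjoint = trans Σ₈-exchange Σ₈-point
segment-path-parity p q a (b ∷ as) disjoint = trans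
  (Σ₈-split (under b p q) (before p b) (before q b))
  (xor-false (segment-parity {p} {q} {a} {b} (λ c c∈ c∈′ → disjoint c c∈ (here c∈′)))
             (segment-path-parity p q b as (λ c c∈ c∈′ → disjoint c c∈ (there c∈′))))

path-parity : ∀ p ps a as → DisjointPaths (p ∷ ps) (a ∷ as) →
              PathParity p (endOf p ps) (p ∷ ps) a (endOf a as) (a ∷ as)
path-parity p [] a as disjoint = Σ₈-point
path-parity p (q ∷ ps) a as disjoint = trans Σ₈-exchange (trans
  (Σ₈-split (pathUnder q (a ∷ as)) (before q a) (before q (endOf a as)))
  (xor-false (trans Σ₈-exchange (segment-path-parity p q a as (λ c c∈ → disjoint c (here c∈))))
             (trans Σ₈-exchange (path-parity q ps a as (λ c c∈ → disjoint c (there c∈))))))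

Σ₆ : (Fin 3 → Fin 3 → Bool) → Bool
Σ₆ t = (t 0F 1F xor t 1F 0F) xor (t 0F 2F xor t 2F 0F) xor (t 1F 2F xor t 2F 1F)

Σ₆-cong : ∀ {s t} → (∀ {j l} → j ≢ l → s j l ≡ t j l) → Σ₆ s ≡ Σ₆ t
Σ₆-cong eq = cong₂ _xor_ (pair (λ ()) (λ ())) (cong₂ _xor_ (pair (λ ()) (λ ())) (pair (λ ()) (λ ())))
  where
  pair = λ {j l} (j≢l : j ≢ l) (l≢j : l ≢ j) → cong₂ _xor_ (eq j≢l) (eq l≢j)

xor-pairs : ∀ x y z w → (x xor y) xor (z xor w) ≡ (x xor z) xor (y xor w)
xor-pairs = solve 4 (λ x y z w → (x :+ y) :+ (z :+ w) := (x :+ z) :+ (y :+ w)) refl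
  where open xor-∧-Solver

Σ₆-xor : ∀ s t → Σ₆ (λ j l → s j l xor t j l) ≡ Σ₆ s xor Σ₆ t
Σ₆-xor s t = trans
  (cong₂ _xor_ (pair 0F 1F) (trans (cong₂ _xor_ (pair 0F 2F) (pair 1F 2F)) (xor-pairs (S 0F 2F) (T 0F 2F) (S 1F 2F) (T 1F 2F))))
  (xor-pairs (S 0F 1F) (T 0F 1F) (S 0F 2F xor S 1F 2F) (T 0F 2F xor T 1F 2F))
  where
  S T : Fin 3 → Fin 3 → Bool
  S j l = s j l xor s l j
  T j l = t j l xor t l j
  pair : ∀ j l → (s j l xor t j l) xor (s l j xor t l j) ≡ S j l xor T j l
  pair j l = xor-pairs (s j l) (t j l) (s l j) (t l j)

Σ₆-flip : ∀ t → Σ₆ (λ j l → t l j) ≡ Σ₆ t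
Σ₆-flip t = cong₂ _xor_ (xor-comm _ (t 0F 1F)) (cong₂ _xor_ (xor-comm _ (t 0F 2F)) (xor-comm _ (t 1F 2F)))

Σ₆-separable : ∀ (α β : Fin 3 → Bool) → Σ₆ (λ j l → α j xor β l) ≡ false
Σ₆-separable α β = solve 6 (λ a b c x y z →
  ((a :+ y) :+ (b :+ x)) :+ (((a :+ z) :+ (c :+ x)) :+ ((b :+ z) :+ (c :+ y))) := con false)
  refl (α 0F) (α 1F) (α 2F) (β 0F) (β 1F) (β 2F)
  where open xor-∧-Solver

Σ₆-antisym : ∀ t → (∀ {j l} → j ≢ l → t j l ≡ true xor t l j) → Σ₆ t ≡ true
Σ₆-antisym t anti = cong₂ _xor_ (pair 0F 1F λ ()) (cong₂ _xor_ (pair 0F 2F λ ()) (pair 1F 2F λ ()))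
  where
  not-xor-same : ∀ x → (true xor x) xor x ≡ true
  not-xor-same true = refl
  not-xor-same false = refl
  pair : ∀ j l → j ≢ l → t j l xor t l j ≡ true
  pair j l j≢l = trans (cong (_xor t l j) (anti j≢l)) (not-xor-same (t l j))

-- Nonplanarity of K₃₃

K₃₃-Free : ∀ {n} → SimpleGraph (Fin n) → Set
K₃₃-Free {n} G = ∀ (b : Fin 3 → Fin n) → Injective _≡_ _≡_ b →
  ∀ {a₁ a₂ a₃} → a₁ ≢ a₂ → a₁ ≢ a₃ → a₂ ≢ a₃ →
  (∀ j → a₁ ~ b j) → (∀ j → a₂ ~ b j) → (∀ j → a₃ ~ b j) → ⊥
  where open SimpleGraph G

module _ {n} (G : SimpleGraph (Fin n)) (drawing : PlaneDrawing G) where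
  open SimpleGraph G
  open PlaneDrawing drawing

  private
    adjacent⇒≢ : ∀ {u v} → u ~ v → u ≢ v
    adjacent⇒≢ u~v u≡v = ~-irr u≡v u~v

  -- Drawings contain an arc only for the pairs (u , v) with u < v.
  ordered : Fin n → Fin n → Fin n × Fin n
  ordered u v with u Fin.<? v
  ... | yes _ = u , v
  ... | no _ = v , u

  ordered-isEdge : ∀ {u v} → u ~ v → IsEdge G (ordered u v)
  ordered-isEdge {u} {v} u~v with u Fin.<? v
  ... | yes u<v = u<v , u~v
  ... | no u≮v with Fin.<-cmp u v
  ...   | tri< u<v _ _ = ⊥-elim (u≮v u<v)
  ...   | tri≈ _ u≡v _ = ⊥-elim (~-irr u≡v u~v)
  ...   | tri> _ _ v<u = v<u , ~-sym u~v

  isEndOf-ordered : ∀ {w} u v → w IsEndOf ordered u v → w IsEndOf (u , v)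
  isEndOf-ordered u v end with u Fin.<? v | end
  ... | yes _ | e = e
  ... | no _ | inj₁ e = inj₂ e
  ... | no _ | inj₂ e = inj₁ e

  edgeUnder : Fin n → Fin n → Fin n → Bool
  edgeUnder w u v = pathUnder (pos w) (arc (ordered u v))

  EdgeParity : (u v a b : Fin n) (e f : Fin n × Fin n) → Set
  EdgeParity u v a b e f = PathParity (pos u) (pos v) (arc e) (pos a) (pos b) (arc f)

  arc-parity : ∀ e f → DisjointPaths (arc e) (arc f) → EdgeParity (proj₁ e) (proj₂ e) (proj₁ f) (proj₂ f) e f
  arc-parity (u , v) (a , b) disjoint = subst₂
    (λ q z → PathParity (pos u) q (arc (u , v)) (pos a) z (arc (a , b)))
    (endOf-++ (pos u) (bends (u , v)) (pos v)) (endOf-++ (pos a) (bends (a , b)) (pos b))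
    (path-parity (pos u) (bends (u , v) ++ [ pos v ]) (pos a) (bends (a , b) ++ [ pos b ]) disjoint)

  edge-parity : ∀ {u v a b} → u ~ v → a ~ b → u ≢ a → u ≢ b → v ≢ a → v ≢ b →
                EdgeParity u v a b (ordered u v) (ordered a b)
  edge-parity {u} {v} {a} {b} u~v a~b u≢a u≢b v≢a v≢b
    with u Fin.<? v | a Fin.<? b | arc-parity (ordered u v) (ordered a b) disjoint
    where
    no-common-end : ∀ {w} → w IsEndOf (u , v) → w IsEndOf (a , b) → ⊥
    no-common-end (inj₁ refl) (inj₁ e) = u≢a e
    no-common-end (inj₁ refl) (inj₂ e) = u≢b e
    no-common-end (inj₂ refl) (inj₁ e) = v≢a e
    no-common-end (inj₂ refl) (inj₂ e) = v≢b e

    distinct : ordered u v ≢ ordered a b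
    distinct e≡f = no-common-end (isEndOf-ordered u v (inj₁ refl)) (isEndOf-ordered a b (inj₁ (cong proj₁ e≡f)))

    disjoint : DisjointPaths (arc (ordered u v)) (arc (ordered a b))
    disjoint c c∈e c∈f =
      let _ , _ , end₁ , end₂ = arc-arc (ordered-isEdge u~v) (ordered-isEdge a~b) distinct c c∈e c∈f
      in no-common-end (isEndOf-ordered u v end₁) (isEndOf-ordered a b end₂)
  ... | yes _ | yes _ | parity = parity
  ... | no _  | yes _ | parity = trans Σ₈-reverse₁ parity
  ... | yes _ | no _  | parity = trans Σ₈-reverse₂ parity
  ... | no _  | no _  | parity = trans Σ₈-reverse₂ (trans Σ₈-reverse₁ parity)

  module _ (b : Fin 3 → Fin n) (b-inj : Injective _≡_ _≡_ b) where
    starParity : Fin n → Bool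
    starParity a = Σ₆ (λ j l → edgeUnder (b l) a (b j))

    -- The relation for the edges a b_j and a′ b_l splits into terms in (j , l)
    -- and terms in j or in l alone; the latter cancel in the sum over j ≠ l.
    starParity-differs : ∀ {a a′} → a ≢ a′ → (∀ j → a ~ b j) → (∀ j → a′ ~ b j) →
                         starParity a xor starParity a′ ≡ true
    starParity-differs {a} {a′} a≢a′ a~b a′~b = begin
      starParity a xor starParity a′
        ≡⟨ cong (starParity a xor_) (Σ₆-flip t′) ⟨
      Σ₆ t xor Σ₆ (λ j l → t′ l j)
        ≡⟨ Σ₆-xor t (λ j l → t′ l j) ⟨
      Σ₆ (λ j l → t j l xor t′ l j)
        ≡⟨ Σ₆-cong {λ j l → t j l xor t′ l j} {λ j l → (α j xor β l) xor h j l} separate ⟩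
      Σ₆ (λ j l → (α j xor β l) xor h j l)
        ≡⟨ Σ₆-xor (λ j l → α j xor β l) h ⟩
      Σ₆ (λ j l → α j xor β l) xor Σ₆ h
        ≡⟨ cong₂ _xor_ (Σ₆-separable α β) (Σ₆-antisym h (λ j≢l → before-not (j≢l ∘ b-inj ∘ pos-injective))) ⟩
      true ∎
      where
      open ≡-Reasoning
      t t′ h : Fin 3 → Fin 3 → Bool
      t j l = edgeUnder (b l) a (b j)
      t′ j l = edgeUnder (b l) a′ (b j)
      h j l = before (pos (b j)) (pos (b l))
      α β : Fin 3 → Bool
      α j = edgeUnder a′ a (b j) xor before (pos (b j)) (pos a′)
      β l = edgeUnder a a′ (b l) xor before (pos a) (pos a′) xor before (pos a) (pos (b l))
      separate : ∀ {j l} → j ≢ l → t j l xor t′ l j ≡ (α j xor β l) xor h j l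
      separate {j} {l} j≢l = Σ₈-isolate (edge-parity (a~b j) (a′~b l)
        a≢a′ (adjacent⇒≢ (a~b l)) (adjacent⇒≢ (a′~b j) ∘ sym) (j≢l ∘ b-inj))

  planar⇒K₃₃-free : K₃₃-Free G
  planar⇒K₃₃-free b b-inj {a₁} {a₂} {a₃} a₁≢a₂ a₁≢a₃ a₂≢a₃ a₁~ a₂~ a₃~ =
    two-values (σ a₁) (σ a₂) (σ a₃)
      (starParity-differs b b-inj a₁≢a₂ a₁~ a₂~)
      (starParity-differs b b-inj a₁≢a₃ a₁~ a₃~)
      (starParity-differs b b-inj a₂≢a₃ a₂~ a₃~)
    where
    σ = starParity b b-inj
    two-values : ∀ x y z → x xor y ≡ true → x xor z ≡ true → y xor z ≡ true → ⊥
    two-values true false false _ _ ()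
    two-values false true true _ _ ()

-- Degrees and discharging

module _ where
  open import Data.Nat.Base
  open import Data.Nat.Properties
  open import Data.Nat.Solver using (module +-*-Solver)
  open import Algebra.Properties.Semiring.Sum +-*-semiring using (sum; ∑-distrib-+; ∑-comm; sum-cong-≗; *-distribˡ-sum)

  𝟙 : {P : Set} → Dec P → ℕ
  𝟙 (yes _) = 1
  𝟙 (no _) = 0

  𝟙-yes : ∀ {P : Set} (P? : Dec P) → P → 𝟙 P? ≡ 1
  𝟙-yes (yes _) _ = refl
  𝟙-yes (no ¬p) p = ⊥-elim (¬p p)

  𝟙-no : ∀ {P : Set} (P? : Dec P) → ¬ P → 𝟙 P? ≡ 0
  𝟙-no (yes p) ¬p = ⊥-elim (¬p p)
  𝟙-no (no _) _ = refl

  𝟙≤1 : ∀ {P : Set} (P? : Dec P) → 𝟙 P? ≤ 1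
  𝟙≤1 (yes _) = ≤-refl
  𝟙≤1 (no _) = z≤n

  count : ∀ {n} {P : Pred (Fin n) 0ℓ} → Decidable P → ℕ
  count P? = sum (λ i → 𝟙 (P? i))

  sum-mono-≤ : ∀ {n} {f g : Fin n → ℕ} → (∀ i → f i ≤ g i) → sum f ≤ sum g
  sum-mono-≤ {zero} f≤g = z≤n
  sum-mono-≤ {suc n} f≤g = +-mono-≤ (f≤g zero) (sum-mono-≤ (f≤g ∘ suc))

  sum-const : ∀ n k → sum {n} (λ _ → k) ≡ n * k
  sum-const zero k = refl
  sum-const (suc n) k = cong (k +_) (sum-const n k)

  term≤sum : ∀ {n} (f : Fin n → ℕ) i → f i ≤ sum f
  term≤sum f zero = m≤m+n _ _
  term≤sum f (suc i) = ≤-trans (term≤sum (f ∘ suc) i) (m≤n+m _ _)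

  choose : ∀ {n k} {P : Pred (Fin n) 0ℓ} (P? : Decidable P) → k ≤ count P? →
           ∃[ f ] Injective {A = Fin k} _≡_ _≡_ f × (∀ i → P (f i))
  choose {k = zero} P? _ = (λ ()) , (λ { {()} }) , λ ()
  choose {suc n} {suc k} P? k< with P? zero
  ... | no _ with choose (P? ∘ suc) k<
  ...   | f , f-inj , Pf = suc ∘ f , f-inj ∘ Fin.suc-injective , Pf
  choose {suc n} {suc k} P? k< | yes p with choose (P? ∘ suc) (s≤s⁻¹ k<)
  ...   | f , f-inj , Pf = g , g-inj , Pg
    where
    g : Fin (suc k) → Fin (suc n)
    g zero = zero
    g (suc i) = suc (f i)
    g-inj : Injective _≡_ _≡_ g
    g-inj {zero} {zero} _ = refl
    g-inj {suc i} {suc j} eq = cong suc (f-inj (Fin.suc-injective eq))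
    Pg : ∀ i → _
    Pg zero = p
    Pg (suc i) = Pf i

  module _ {n} {P : Pred (Fin n) 0ℓ} (P? : Decidable P) where
    count-empty : (∀ i → ¬ P i) → count P? ≤ 0
    count-empty none with count P? ≤? 0
    ... | yes ≤0 = ≤0
    ... | no ≰0 with choose P? (≰⇒> ≰0)
    ...   | f , _ , Pf = ⊥-elim (none (f zero) (Pf zero))

    count-unique : (∀ {i j} → P i → P j → i ≡ j) → count P? ≤ 1
    count-unique unique with count P? ≤? 1
    ... | yes ≤1 = ≤1
    ... | no ≰1 with choose P? (≰⇒> ≰1)
    ...   | f , f-inj , Pf with f-inj (unique (Pf zero) (Pf (suc zero)))
    ...     | ()

    count-positive : ∀ {i} → P i → 1 ≤ count P?
    count-positive {i} p = subst (_≤ count P?) (𝟙-yes (P? i) p) (term≤sum (λ i → 𝟙 (P? i)) i)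

  module _ {n} {P Q R : Pred (Fin n) 0ℓ} (P? : Decidable P) (Q? : Decidable Q) (R? : Decidable R) where
    count-cover : (∀ {i} → P i → Q i ⊎ R i) → count P? ≤ count Q? + count R?
    count-cover cover = ≤-trans (sum-mono-≤ pointwise) (≤-reflexive (∑-distrib-+ (𝟙 ∘ Q?) (𝟙 ∘ R?)))
      where
      pointwise : ∀ i → 𝟙 (P? i) ≤ 𝟙 (Q? i) + 𝟙 (R? i)
      pointwise i with P? i | Q? i | R? i
      ... | no _ | _ | _ = z≤n
      ... | yes _ | yes _ | _ = s≤s z≤n
      ... | yes _ | no _ | yes _ = s≤s z≤n
      ... | yes p | no ¬q | no ¬r = ⊥-elim ([ ¬q , ¬r ]′ (cover p))

    count-inclusion-exclusion : (∀ {i} → P i ⊎ Q i → R i) →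
      count P? + count Q? ≤ count (λ i → P? i ×-dec Q? i) + count R?
    count-inclusion-exclusion union = subst₂ _≤_
      (∑-distrib-+ (𝟙 ∘ P?) (𝟙 ∘ Q?)) (∑-distrib-+ (λ i → 𝟙 (P? i ×-dec Q? i)) (𝟙 ∘ R?)) (sum-mono-≤ pointwise)
      where
      pointwise : ∀ i → 𝟙 (P? i) + 𝟙 (Q? i) ≤ 𝟙 (P? i ×-dec Q? i) + 𝟙 (R? i)
      pointwise i with P? i | Q? i | R? i
      ... | no _ | no _ | _ = z≤n
      ... | no _ | yes _ | yes _ = ≤-refl
      ... | yes _ | no _ | yes _ = ≤-refl
      ... | yes _ | yes _ | yes _ = ≤-refl
      ... | yes p | _ | no ¬r = ⊥-elim (¬r (union (inj₁ p)))
      ... | no _ | yes q | no ¬r = ⊥-elim (¬r (union (inj₂ q)))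

  module _ {n} {P Q : Pred (Fin n) 0ℓ} (P? : Decidable P) (Q? : Decidable Q) where
    count-⊂ : (∀ {i} → P i → Q i) → ∀ {i} → Q i → ¬ P i → count P? < count Q?
    count-⊂ P⊆Q {i} q ¬p = begin
      1 + count P?
        ≡⟨ +-comm 1 _ ⟩
      count P? + 1
        ≤⟨ +-monoʳ-≤ (count P?) (count-positive (Fin._≟ i) refl) ⟩
      count P? + count (Fin._≟ i)
        ≤⟨ count-inclusion-exclusion P? (Fin._≟ i) Q? [ P⊆Q , (λ { refl → q }) ]′ ⟩
      count (λ j → P? j ×-dec (j Fin.≟ i)) + count Q?
        ≤⟨ +-monoˡ-≤ _ (count-empty (λ j → P? j ×-dec (j Fin.≟ i)) (λ { _ (p , refl) → ¬p p })) ⟩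
      count Q? ∎
      where open ≤-Reasoning

  count-remove : ∀ {n} {P : Pred (Fin n) 0ℓ} (P? : Decidable P) y →
                 count P? ≤ count (λ z → P? z ×-dec ¬? (z Fin.≟ y)) + 1
  count-remove {P = P} P? y = ≤-trans
    (count-cover P? (λ z → P? z ×-dec ¬? (z Fin.≟ y)) (Fin._≟ y) classify)
    (+-monoʳ-≤ _ (count-unique (Fin._≟ y) (λ { refl refl → refl })))
    where
    classify : ∀ {z} → P z → (P z × z ≢ y) ⊎ z ≡ y
    classify {z} p with z Fin.≟ y
    ... | yes e = inj₂ e
    ... | no ≢y = inj₁ (p , ≢y)

  module _ {n} {P : Pred (Fin n) 0ℓ} (P? : Decidable P) (k : ℕ) {f : Fin n → ℕ} where
    scaled-sum : sum (λ i → k * 𝟙 (P? i)) ≡ k * count P?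
    scaled-sum = sym (*-distribˡ-sum k (𝟙 ∘ P?))

    sum≤k*count : (∀ i → f i ≤ k * 𝟙 (P? i)) → sum f ≤ k * count P?
    sum≤k*count bound = ≤-trans (sum-mono-≤ bound) (≤-reflexive scaled-sum)

    k*count≤sum : (∀ {i} → P i → k ≤ f i) → k * count P? ≤ sum f
    k*count≤sum bound = ≤-trans (≤-reflexive (sym scaled-sum)) (sum-mono-≤ pointwise)
      where
      pointwise : ∀ i → k * 𝟙 (P? i) ≤ f i
      pointwise i with P? i
      ... | yes p = subst (_≤ f i) (sym (*-identityʳ k)) (bound p)
      ... | no _ = subst (_≤ f i) (sym (*-zeroʳ k)) z≤n

  module _ {n} (G : SimpleGraph (Fin n)) where
    open SimpleGraph G

    degree : Fin n → ℕ
    degree v = count (v ~?_)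

    outside? : ∀ x y → Decidable (λ z → x ~ z × z ≢ y × ¬ y ~ z)
    outside? x y z = (x ~? z) ×-dec ¬? (z Fin.≟ y) ×-dec ¬? (y ~? z)

    low? : ∀ y → Decidable (λ x → y ~ x × degree x ≤ 5)
    low? y x = (y ~? x) ×-dec (degree x ≤? 5)

    high? : ∀ y → Decidable (λ x → y ~ x × 6 ≤ degree x)
    high? y x = (y ~? x) ×-dec (6 ≤? degree x)

    module _ {x y a₁ a₂ : Fin n} (x~y : x ~ y) (x~a₁ : x ~ a₁) (x~a₂ : x ~ a₂)
             (a₁≢y : a₁ ≢ y) (a₂≢y : a₂ ≢ y) (a₁≢a₂ : a₁ ≢ a₂)
             (leaf : Fin 5 → Fin n) (leaf-inj : Injective _≡_ _≡_ leaf)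
             (y~leaf : ∀ i → y ~ leaf i) (leaf≢x : ∀ i → leaf i ≢ x)
             (leaf≢a₁ : ∀ i → leaf i ≢ a₁) (leaf≢a₂ : ∀ i → leaf i ≢ a₂) where
      private
        embed : DSVertex 2 5 → Fin n
        embed xᵉ = x
        embed yᵉ = y
        embed (xleaf 0F) = a₁
        embed (xleaf 1F) = a₂
        embed (yleaf j) = leaf j

        embed-hom : ∀ {u v} → DSEdge u v → embed u ~ embed v
        embed-hom backbone = x~y
        embed-hom (xedge 0F) = x~a₁
        embed-hom (xedge 1F) = x~a₂
        embed-hom (yedge j) = y~leaf j

        embed-inj : Injective _≡_ _≡_ embed
        embed-inj {xᵉ} {xᵉ} _ = refl
        embed-inj {xᵉ} {yᵉ} eq = ⊥-elim (~-irr eq x~y)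
        embed-inj {xᵉ} {xleaf 0F} eq = ⊥-elim (~-irr eq x~a₁)
        embed-inj {xᵉ} {xleaf 1F} eq = ⊥-elim (~-irr eq x~a₂)
        embed-inj {xᵉ} {yleaf j} eq = ⊥-elim (leaf≢x j (sym eq))
        embed-inj {yᵉ} {xᵉ} eq = ⊥-elim (~-irr (sym eq) x~y)
        embed-inj {yᵉ} {yᵉ} _ = refl
        embed-inj {yᵉ} {xleaf 0F} eq = ⊥-elim (a₁≢y (sym eq))
        embed-inj {yᵉ} {xleaf 1F} eq = ⊥-elim (a₂≢y (sym eq))
        embed-inj {yᵉ} {yleaf j} eq = ⊥-elim (~-irr eq (y~leaf j))
        embed-inj {xleaf 0F} {xᵉ} eq = ⊥-elim (~-irr (sym eq) x~a₁)
        embed-inj {xleaf 1F} {xᵉ} eq = ⊥-elim (~-irr (sym eq) x~a₂)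
        embed-inj {xleaf 0F} {yᵉ} eq = ⊥-elim (a₁≢y eq)
        embed-inj {xleaf 1F} {yᵉ} eq = ⊥-elim (a₂≢y eq)
        embed-inj {xleaf 0F} {xleaf 0F} _ = refl
        embed-inj {xleaf 0F} {xleaf 1F} eq = ⊥-elim (a₁≢a₂ eq)
        embed-inj {xleaf 1F} {xleaf 0F} eq = ⊥-elim (a₁≢a₂ (sym eq))
        embed-inj {xleaf 1F} {xleaf 1F} _ = refl
        embed-inj {xleaf 0F} {yleaf j} eq = ⊥-elim (leaf≢a₁ j (sym eq))
        embed-inj {xleaf 1F} {yleaf j} eq = ⊥-elim (leaf≢a₂ j (sym eq))
        embed-inj {yleaf i} {xᵉ} eq = ⊥-elim (leaf≢x i eq)
        embed-inj {yleaf i} {yᵉ} eq = ⊥-elim (~-irr (sym eq) (y~leaf i))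
        embed-inj {yleaf i} {xleaf 0F} eq = ⊥-elim (leaf≢a₁ i eq)
        embed-inj {yleaf i} {xleaf 1F} eq = ⊥-elim (leaf≢a₂ i eq)
        embed-inj {yleaf i} {yleaf j} eq = cong yleaf (leaf-inj eq)

      contains-doubleStar : Contains G (doubleStar 2 5)
      contains-doubleStar = embed , embed-inj , λ { (fwd e) → embed-hom e ; (bwd e) → ~-sym (embed-hom e) }

    module _ (free : ¬ Contains G (doubleStar 2 5)) where

      degree-bound : ∀ {x y a₁ a₂} → x ~ y → x ~ a₁ → x ~ a₂ → a₁ ≢ y → a₂ ≢ y → a₁ ≢ a₂ →
                     degree y ≤ 5 + (𝟙 (y ~? a₁) + 𝟙 (y ~? a₂))
      degree-bound {x} {y} {a₁} {a₂} x~y x~a₁ x~a₂ a₁≢y a₂≢y a₁≢a₂ = begin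
        degree y
          ≤⟨ count-cover (y ~?_) leaf? excluded? classify ⟩
        count leaf? + count excluded?
          ≤⟨ +-mono-≤ leaves≤4 (≤-trans (count-cover excluded? x≡? a₁∨a₂? id)
               (+-mono-≤ (count-unique x≡? (λ { (_ , refl) (_ , refl) → refl }))
                         (≤-trans (count-cover a₁∨a₂? a₁≡? a₂≡? id) (+-mono-≤ (at-most a₁) (at-most a₂))))) ⟩
        5 + (𝟙 (y ~? a₁) + 𝟙 (y ~? a₂)) ∎
        where
        open ≤-Reasoning
        is? : ∀ a → Decidable (λ z → y ~ z × z ≡ a)
        is? a z = (y ~? z) ×-dec (z Fin.≟ a)
        x≡? = is? x
        a₁≡? = is? a₁
        a₂≡? = is? a₂
        a₁∨a₂? = λ z → a₁≡? z ⊎-dec a₂≡? z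
        excluded? = λ z → x≡? z ⊎-dec a₁∨a₂? z
        leaf? : Decidable (λ z → y ~ z × z ≢ x × z ≢ a₁ × z ≢ a₂)
        leaf? z = (y ~? z) ×-dec ¬? (z Fin.≟ x) ×-dec ¬? (z Fin.≟ a₁) ×-dec ¬? (z Fin.≟ a₂)
        classify : ∀ {z} → y ~ z → (y ~ z × z ≢ x × z ≢ a₁ × z ≢ a₂) ⊎
                                   ((y ~ z × z ≡ x) ⊎ ((y ~ z × z ≡ a₁) ⊎ (y ~ z × z ≡ a₂)))
        classify {z} y~z with z Fin.≟ x | z Fin.≟ a₁ | z Fin.≟ a₂
        ... | yes e | _ | _ = inj₂ (inj₁ (y~z , e))
        ... | no _ | yes e | _ = inj₂ (inj₂ (inj₁ (y~z , e)))
        ... | no _ | no _ | yes e = inj₂ (inj₂ (inj₂ (y~z , e)))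
        ... | no x≢ | no a₁≢ | no a₂≢ = inj₁ (y~z , x≢ , a₁≢ , a₂≢)
        at-most : ∀ a → count (is? a) ≤ 𝟙 (y ~? a)
        at-most a with y ~? a
        ... | yes _ = count-unique (is? a) (λ { (_ , refl) (_ , refl) → refl })
        ... | no y≁a = count-empty (is? a) (λ { _ (y~z , refl) → y≁a y~z })
        leaves≤4 : count leaf? ≤ 4
        leaves≤4 = ≮⇒≥ λ many → let f , f-inj , Pf = choose leaf? many in
          free (contains-doubleStar x~y x~a₁ x~a₂ a₁≢y a₂≢y a₁≢a₂ f f-inj (proj₁ ∘ Pf)
            (proj₁ ∘ proj₂ ∘ Pf) (proj₁ ∘ proj₂ ∘ proj₂ ∘ Pf) (proj₂ ∘ proj₂ ∘ proj₂ ∘ Pf))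

      neighbours-of-≥8 : ∀ {x y} → 8 ≤ degree y → x ~ y → degree x ≤ 2
      neighbours-of-≥8 {x} {y} 8≤ x~y = ≮⇒≥ λ 3≤ →
        let f , f-inj , Pf = choose {k = 2} (λ z → (x ~? z) ×-dec ¬? (z Fin.≟ y))
                               (+-cancelʳ-≤ 1 _ _ (≤-trans 3≤ (count-remove (x ~?_) y)))
            a₁ = f 0F
            a₂ = f 1F
            a₁≢a₂ : a₁ ≢ a₂
            a₁≢a₂ e = Fin.0≢1+n (f-inj e)
        in <⇒≱ 8≤ (≤-trans
             (degree-bound x~y (proj₁ (Pf 0F)) (proj₁ (Pf 1F)) (proj₂ (Pf 0F)) (proj₂ (Pf 1F)) a₁≢a₂)
             (+-monoʳ-≤ 5 (+-mono-≤ (𝟙≤1 (y ~? a₁)) (𝟙≤1 (y ~? a₂)))))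

      neighbourhood-of-7 : ∀ {x y a} → 7 ≤ degree y → x ~ y → 3 ≤ degree x → x ~ a → a ≢ y → y ~ a
      neighbourhood-of-7 {x} {y} {a} 7≤ x~y 3≤ x~a a≢y with y ~? a
      ... | yes y~a = y~a
      ... | no y≁a =
        let Q? = λ z → (x ~? z) ×-dec ¬? (z Fin.≟ y)
            f , f-inj , Pf = choose {k = 1} (λ z → Q? z ×-dec ¬? (z Fin.≟ a))
              (+-cancelʳ-≤ 1 _ _ (≤-trans (+-cancelʳ-≤ 1 _ _ (≤-trans 3≤ (count-remove (x ~?_) y))) (count-remove Q? a)))
            b = f 0F
            (x~b , b≢y) , b≢a = Pf 0F
        in ⊥-elim (<⇒≱ 7≤ (≤-trans (degree-bound x~y x~a x~b a≢y b≢y (b≢a ∘ sym))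
             (+-monoʳ-≤ 5 (+-mono-≤ (≤-reflexive (𝟙-no (y ~? a) y≁a)) (𝟙≤1 (y ~? b))))))

      outside-of-6 : ∀ {x y} → 6 ≤ degree y → x ~ y → count (outside? x y) ≤ 1
      outside-of-6 {x} {y} 6≤ x~y = count-unique (outside? x y) unique
        where
        unique : ∀ {a b} → x ~ a × a ≢ y × ¬ y ~ a → x ~ b × b ≢ y × ¬ y ~ b → a ≡ b
        unique {a} {b} (x~a , a≢y , y≁a) (x~b , b≢y , y≁b) with a Fin.≟ b
        ... | yes a≡b = a≡b
        ... | no a≢b = ⊥-elim (<⇒≱ 6≤ (≤-trans (degree-bound x~y x~a x~b a≢y b≢y a≢b)
                (+-monoʳ-≤ 5 (+-mono-≤ (≤-reflexive (𝟙-no (y ~? a) y≁a)) (≤-reflexive (𝟙-no (y ~? b) y≁b))))))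

      module _ (K₃₃-free : K₃₃-Free G) where

        K₃₃-free-common : ∀ {a₁ a₂ a₃} → a₁ ≢ a₂ → a₁ ≢ a₃ → a₂ ≢ a₃ →
          {P : Pred (Fin n) 0ℓ} (P? : Decidable P) → (∀ {z} → P z → a₁ ~ z × a₂ ~ z × a₃ ~ z) →
          ¬ 3 ≤ count P?
        K₃₃-free-common a₁≢a₂ a₁≢a₃ a₂≢a₃ P? common 3≤ =
          let f , f-inj , Pf = choose P? 3≤ in
          K₃₃-free f f-inj a₁≢a₂ a₁≢a₃ a₂≢a₃
            (proj₁ ∘ common ∘ Pf) (proj₁ ∘ proj₂ ∘ common ∘ Pf) (proj₂ ∘ proj₂ ∘ common ∘ Pf)

        high-neighbours-of-7 : ∀ {y} → degree y ≡ 7 → count (high? y) ≤ 1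
        high-neighbours-of-7 {y} deg7 = count-unique (high? y) unique
          where
          7≤ = ≤-reflexive (sym deg7)
          other? : ∀ x → Decidable (λ z → x ~ z × z ≢ y)
          other? x z = (x ~? z) ×-dec ¬? (z Fin.≟ y)
          5≤other : ∀ {x} → 6 ≤ degree x → 5 ≤ count (other? x)
          5≤other {x} 6≤ = +-cancelʳ-≤ 1 _ _ (≤-trans 6≤ (count-remove (x ~?_) y))
          into : ∀ {x} → y ~ x → 6 ≤ degree x → ∀ {z} → x ~ z × z ≢ y → y ~ z
          into y~x 6≤ (x~z , z≢y) = neighbourhood-of-7 7≤ (~-sym y~x) (≤-trans (m≤m+n 3 3) 6≤) x~z z≢y
          unique : ∀ {u v} → y ~ u × 6 ≤ degree u → y ~ v × 6 ≤ degree v → u ≡ v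
          unique {u} {v} (y~u , 6≤u) (y~v , 6≤v) with u Fin.≟ v
          ... | yes u≡v = u≡v
          ... | no u≢v = ⊥-elim (K₃₃-free-common (λ e → ~-irr e y~u) (λ e → ~-irr e y~v) u≢v
                  (λ z → other? u z ×-dec other? v z)
                  (λ { (p , q) → into y~u 6≤u p , proj₁ p , proj₁ q })
                  (+-cancelʳ-≤ 7 _ _ (≤-trans (+-mono-≤ (5≤other 6≤u) (5≤other 6≤v)) (≤-trans
                    (count-inclusion-exclusion (other? u) (other? v) (y ~?_) [ into y~u 6≤u , into y~v 6≤v ]′)
                    (+-monoʳ-≤ _ (≤-reflexive deg7))))))

        high-neighbours-of-6 : ∀ {y} → degree y ≡ 6 → count (high? y) ≤ 4
        high-neighbours-of-6 {y} deg6 = ≮⇒≥ (λ 5≤ → five (choose (high? y) 5≤))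
          where
          inside? : ∀ x → Decidable (λ z → x ~ z × y ~ z)
          inside? x z = (x ~? z) ×-dec (y ~? z)
          4≤inside : ∀ {x} → y ~ x → 6 ≤ degree x → 4 ≤ count (inside? x)
          4≤inside {x} y~x 6≤ = +-cancelʳ-≤ 1 _ _ (+-cancelʳ-≤ 1 _ _ (begin
            6                                             ≤⟨ 6≤ ⟩
            degree x                                      ≤⟨ count-remove (x ~?_) y ⟩
            count other? + 1                              ≤⟨ +-monoˡ-≤ 1 (count-cover other? (inside? x) (outside? x y) classify) ⟩
            count (inside? x) + count (outside? x y) + 1  ≤⟨ +-monoˡ-≤ 1 (+-monoʳ-≤ (count (inside? x)) outside≤1) ⟩
            count (inside? x) + 1 + 1                     ∎))
            where
            open ≤-Reasoning
            other? : Decidable (λ z → x ~ z × z ≢ y)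
            other? z = (x ~? z) ×-dec ¬? (z Fin.≟ y)
            outside≤1 : count (outside? x y) ≤ 1
            outside≤1 = outside-of-6 (≤-reflexive (sym deg6)) (~-sym y~x)
            classify : ∀ {z} → x ~ z × z ≢ y → (x ~ z × y ~ z) ⊎ (x ~ z × z ≢ y × ¬ y ~ z)
            classify {z} (x~z , z≢y) with y ~? z
            ... | yes y~z = inj₁ (x~z , y~z)
            ... | no y≁z = inj₂ (x~z , z≢y , y≁z)
          adjacent : ∀ {c d} → c ≢ d → y ~ c × 6 ≤ degree c → y ~ d × 6 ≤ degree d → c ~ d
          adjacent {c} {d} c≢d (y~c , 6≤c) (y~d , 6≤d) = decidable-stable (c ~? d) λ c≁d →
            let rest? : Decidable (λ z → y ~ z × z ≢ c)
                rest? z = (y ~? z) ×-dec ¬? (z Fin.≟ c)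
                into : ∀ {z} → (c ~ z × y ~ z) ⊎ (d ~ z × y ~ z) → y ~ z × z ≢ c
                into = [ (λ { (c~z , y~z) → y~z , λ e → ~-irr (sym e) c~z })
                       , (λ { (d~z , y~z) → y~z , λ { refl → c≁d (~-sym d~z) } }) ]′
                rest≤5 : count rest? ≤ 5
                rest≤5 = s≤s⁻¹ (subst (count rest? <_) deg6 (count-⊂ rest? (y ~?_) proj₁ y~c (λ r → proj₂ r refl)))
            in K₃₃-free-common (λ e → ~-irr e y~c) (λ e → ~-irr e y~d) c≢d
                 (λ z → inside? c z ×-dec inside? d z)
                 (λ { ((c~z , y~z) , (d~z , _)) → y~z , c~z , d~z })
                 (+-cancelʳ-≤ 5 _ _ (≤-trans (+-mono-≤ (4≤inside y~c 6≤c) (4≤inside y~d 6≤d))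
                   (≤-trans (count-inclusion-exclusion (inside? c) (inside? d) rest? into) (+-monoʳ-≤ _ rest≤5))))
          five : ¬ (∃[ f ] Injective {A = Fin 5} _≡_ _≡_ f × (∀ i → y ~ f i × 6 ≤ degree (f i)))
          five (f , f-inj , Hf) = K₃₃-free
            (λ j → f (suc (suc j))) (λ e → Fin.suc-injective (Fin.suc-injective (f-inj e)))
            (λ e → ~-irr e (proj₁ (Hf 0F))) (λ e → ~-irr e (proj₁ (Hf 1F))) (λ e → Fin.0≢1+n (f-inj e))
            (λ j → proj₁ (Hf (suc (suc j))))
            (λ j → adjacent (λ e → Fin.0≢1+n (f-inj e)) (Hf 0F) (Hf (suc (suc j))))
            (λ j → adjacent (λ e → Fin.0≢1+n (Fin.suc-injective (f-inj e))) (Hf 1F) (Hf (suc (suc j))))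

  demand : ℕ → ℕ
  demand 6 = 1
  demand 7 = 2
  demand _ = 0

  gift : ℕ → ℕ → ℕ
  gift 0 e = 13
  gift 1 e = 13
  gift 2 e = 13
  gift 3 e = demand e
  gift 4 e = demand e
  gift 5 e = demand e
  gift _ e = 0

  demand≤2 : ∀ e → demand e ≤ 2
  demand≤2 0 = z≤n
  demand≤2 1 = z≤n
  demand≤2 2 = z≤n
  demand≤2 3 = z≤n
  demand≤2 4 = z≤n
  demand≤2 5 = z≤n
  demand≤2 6 = s≤s z≤n
  demand≤2 7 = ≤-refl
  demand≤2 (suc (suc (suc (suc (suc (suc (suc (suc _)))))))) = z≤n

  demand≤1 : ∀ e → e ≢ 7 → demand e ≤ 1
  demand≤1 0 _ = z≤n
  demand≤1 1 _ = z≤n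
  demand≤1 2 _ = z≤n
  demand≤1 3 _ = z≤n
  demand≤1 4 _ = z≤n
  demand≤1 5 _ = z≤n
  demand≤1 6 _ = ≤-refl
  demand≤1 7 ≢7 = ⊥-elim (≢7 refl)
  demand≤1 (suc (suc (suc (suc (suc (suc (suc (suc _)))))))) _ = z≤n

  demand-low : ∀ e → e < 6 → demand e ≡ 0
  demand-low 0 _ = refl
  demand-low 1 _ = refl
  demand-low 2 _ = refl
  demand-low 3 _ = refl
  demand-low 4 _ = refl
  demand-low 5 _ = refl
  demand-low (suc (suc (suc (suc (suc (suc _)))))) (s≤s (s≤s (s≤s (s≤s (s≤s (s≤s ()))))))

  gift-≤2 : ∀ {d} e → d ≤ 2 → gift d e ≡ 13
  gift-≤2 e z≤n = refl
  gift-≤2 e (s≤s z≤n) = refl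
  gift-≤2 e (s≤s (s≤s z≤n)) = refl

  gift-≥3 : ∀ {d} e → 3 ≤ d → d ≤ 5 → gift d e ≡ demand e
  gift-≥3 e (s≤s (s≤s (s≤s z≤n))) (s≤s (s≤s (s≤s z≤n))) = refl
  gift-≥3 e (s≤s (s≤s (s≤s z≤n))) (s≤s (s≤s (s≤s (s≤s z≤n)))) = refl
  gift-≥3 e (s≤s (s≤s (s≤s z≤n))) (s≤s (s≤s (s≤s (s≤s (s≤s z≤n))))) = refl

  demand≤gift : ∀ {d} e → d ≤ 5 → demand e ≤ gift d e
  demand≤gift {d} e d≤5 with d ≤? 2
  ... | yes d≤2 = ≤-trans (demand≤2 e) (subst (2 ≤_) (sym (gift-≤2 e d≤2)) (m≤m+n 2 11))
  ... | no d≰2 = ≤-reflexive (sym (gift-≥3 e (≰⇒> d≰2) d≤5))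

  module _ {n} (G : SimpleGraph (Fin n)) where
    open SimpleGraph G

    private
      deg = degree G

    transfer : Fin n → Fin n → ℕ
    transfer u v = 𝟙 (u ~? v) * gift (deg u) (deg v)

    out into : Fin n → ℕ
    out v = sum (λ u → transfer v u)
    into v = sum (λ u → transfer u v)

    gift≤transfer : ∀ {u v} → v ~ u → gift (deg u) (deg v) ≤ transfer u v
    gift≤transfer {u} {v} v~u = ≤-reflexive (trans (sym (*-identityˡ _))
      (cong (_* gift (deg u) (deg v)) (sym (𝟙-yes (u ~? v) (~-sym v~u)))))

    out≤ : ∀ k v → (∀ {u} → v ~ u → gift (deg v) (deg u) ≤ k) → out v ≤ k * deg v
    out≤ k v bound = sum≤k*count (v ~?_) k pointwise
      where
      pointwise : ∀ u → 𝟙 (v ~? u) * gift (deg v) (deg u) ≤ k * 𝟙 (v ~? u)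
      pointwise u with v ~? u
      ... | yes v~u = subst₂ _≤_ (sym (*-identityˡ _)) (sym (*-identityʳ k)) (bound v~u)
      ... | no _ = z≤n

    into≥ : ∀ k {v} {P : Pred (Fin n) 0ℓ} (P? : Decidable P) →
            (∀ {u} → P u → v ~ u × k ≤ gift (deg u) (deg v)) → k * count P? ≤ into v
    into≥ k {v} P? bound = k*count≤sum P? k (λ p → ≤-trans (proj₂ (bound p)) (gift≤transfer (proj₁ (bound p))))

    module _ (free : ¬ Contains G (doubleStar 2 5)) (K₃₃-free : K₃₃-Free G) where

      degree≤low+high : ∀ y → deg y ≤ count (low? G y) + count (high? G y)
      degree≤low+high y = count-cover (y ~?_) (low? G y) (high? G y) classify
        where
        classify : ∀ {x} → y ~ x → (y ~ x × deg x ≤ 5) ⊎ (y ~ x × 6 ≤ deg x)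
        classify {x} y~x with deg x ≤? 5
        ... | yes ≤5 = inj₁ (y~x , ≤5)
        ... | no ≰5 = inj₂ (y~x , ≰⇒> ≰5)

      Balanced : Fin n → Set
      Balanced v = 7 * deg v + out v ≤ 40 + into v

      balanced-if : ∀ v {d o i} → deg v ≤ d → out v ≤ o → i ≤ into v → 7 * d + o ≤ 40 + i → Balanced v
      balanced-if v d o i le = ≤-trans (+-mono-≤ (*-monoʳ-≤ 7 d) o) (≤-trans le (+-monoʳ-≤ 40 i))

      balanced-≤2 : ∀ v → deg v ≤ 2 → Balanced v
      balanced-≤2 v d≤2 = balanced-if v d≤2
        (≤-trans (out≤ 13 v (λ {u} _ → ≤-reflexive (gift-≤2 (deg u) d≤2))) (*-monoʳ-≤ 13 d≤2)) z≤n ≤-refl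

      balanced-3-4 : ∀ v → 3 ≤ deg v → deg v ≤ 4 → Balanced v
      balanced-3-4 v 3≤ ≤4 = balanced-if v ≤4
        (≤-trans (out≤ 2 v (λ {u} _ → ≤-trans (≤-reflexive (gift-≥3 (deg u) 3≤ (m≤n⇒m≤1+n ≤4))) (demand≤2 (deg u))))
                 (*-monoʳ-≤ 2 ≤4))
        z≤n (m≤m+n 36 4)

      balanced-5 : ∀ v → deg v ≡ 5 → Balanced v
      balanced-5 v deg5 with Fin.any? (λ y → (v ~? y) ×-dec (deg y ≟ 7))
      ... | no none = balanced-if v (≤-reflexive deg5)
          (≤-trans (out≤ 1 v (λ {u} v~u → ≤-trans (≤-reflexive (gift-5 u)) (demand≤1 (deg u) (λ e → none (u , v~u , e)))))
                   (≤-reflexive (cong (1 *_) deg5)))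
          z≤n ≤-refl
        where
        gift-5 : ∀ u → gift (deg v) (deg u) ≡ demand (deg u)
        gift-5 u = cong (λ d → gift d (deg u)) deg5
      ... | yes (y , v~y , deg7) = balanced-if v (≤-reflexive deg5)
          (≤-trans (sum≤k*count (high? G v) 2 pointwise) (*-monoʳ-≤ 2 high≤2)) z≤n (m≤m+n 39 1)
        where
        1*gift : ∀ u → 1 * gift (deg v) (deg u) ≡ demand (deg u)
        1*gift u = trans (*-identityˡ _) (cong (λ d → gift d (deg u)) deg5)
        pointwise : ∀ u → 𝟙 (v ~? u) * gift (deg v) (deg u) ≤ 2 * 𝟙 (high? G v u)
        pointwise u with v ~? u | 6 ≤? deg u
        ... | no _ | _ = z≤n
        ... | yes _ | yes _ = ≤-trans (≤-reflexive (1*gift u)) (demand≤2 (deg u))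
        ... | yes _ | no ≱6 = ≤-reflexive (trans (1*gift u) (demand-low (deg u) (≰⇒> ≱6)))
        high≤2 : count (high? G v) ≤ 2
        high≤2 = ≤-trans
          (count-cover (high? G v) (Fin._≟ y) (high? G y) classify)
          (+-mono-≤ (count-unique (Fin._≟ y) (λ { refl refl → refl })) (high-neighbours-of-7 G free K₃₃-free deg7))
          where
          classify : ∀ {u} → v ~ u × 6 ≤ deg u → u ≡ y ⊎ (y ~ u × 6 ≤ deg u)
          classify {u} (v~u , 6≤) with u Fin.≟ y
          ... | yes u≡y = inj₁ u≡y
          ... | no u≢y = inj₂ (neighbourhood-of-7 G free (≤-reflexive (sym deg7)) v~y
                  (subst (3 ≤_) (sym deg5) (m≤m+n 3 2)) v~u u≢y , 6≤)

      out-high : ∀ v → 6 ≤ deg v → out v ≤ 0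
      out-high v 6≤ = out≤ 0 v (λ {u} _ → ≤-reflexive (gift-≥6 (deg u) 6≤))
        where
        gift-≥6 : ∀ {d} e → 6 ≤ d → gift d e ≡ 0
        gift-≥6 e (s≤s (s≤s (s≤s (s≤s (s≤s (s≤s z≤n)))))) = refl

      balanced-6 : ∀ v → deg v ≡ 6 → Balanced v
      balanced-6 v deg6 = balanced-if v (≤-reflexive deg6) (out-high v (≤-reflexive (sym deg6)))
        (≤-trans (*-monoʳ-≤ 1 2≤low) (into≥ 1 (low? G v) (λ { {u} (v~u , ≤5) →
          v~u , subst (λ e → 1 ≤ gift (deg u) e) (sym deg6) (demand≤gift 6 ≤5) }))) ≤-refl
        where
        2≤low : 2 ≤ count (low? G v)
        2≤low = +-cancelʳ-≤ 4 _ _ (≤-trans (≤-reflexive (sym deg6))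
          (≤-trans (degree≤low+high v) (+-monoʳ-≤ _ (high-neighbours-of-6 G free K₃₃-free deg6))))

      balanced-7 : ∀ v → deg v ≡ 7 → Balanced v
      balanced-7 v deg7 with Fin.any? (λ u → (v ~? u) ×-dec (deg u ≤? 2))
      ... | yes (u , v~u , ≤2) = balanced-if v (≤-reflexive deg7) (out-high v (≤-trans (n≤1+n 6) (≤-reflexive (sym deg7))))
          (≤-trans (≤-trans (≤-reflexive (sym (gift-≤2 (deg v) ≤2))) (gift≤transfer v~u)) (term≤sum (λ u → transfer u v) u))
          (m≤m+n 49 4)
      ... | no none = balanced-if v (≤-reflexive deg7) (out-high v (≤-trans (n≤1+n 6) (≤-reflexive (sym deg7))))
          (≤-trans (*-monoʳ-≤ 2 6≤low) (into≥ 2 (low? G v) (λ { {u} (v~u , ≤5) →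
            v~u , subst (λ e → 2 ≤ gift (deg u) e) (sym deg7) (demand≤gift 7 ≤5) })))
          (m≤m+n 49 3)
        where
        6≤low : 6 ≤ count (low? G v)
        6≤low = +-cancelʳ-≤ 1 _ _ (≤-trans (≤-reflexive (sym deg7))
          (≤-trans (degree≤low+high v) (+-monoʳ-≤ _ (high-neighbours-of-7 G free K₃₃-free deg7))))

      balanced-≥8 : ∀ v → 8 ≤ deg v → Balanced v
      balanced-≥8 v 8≤ = balanced-if v ≤-refl (out-high v (≤-trans (m≤m+n 6 2) 8≤))
        (into≥ 13 (v ~?_) (λ {u} v~u → v~u , ≤-reflexive (sym (gift-≤2 (deg v) (neighbours-of-≥8 G free 8≤ (~-sym v~u))))))
        (≤-trans (≤-reflexive (+-identityʳ _)) (≤-trans (*-monoˡ-≤ (deg v) (m≤m+n 7 6)) (m≤n+m _ 40)))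

      balanced : ∀ v → Balanced v
      balanced v with deg v ≤? 2 | deg v ≤? 4 | deg v ≟ 5 | deg v ≟ 6 | deg v ≟ 7
      ... | yes ≤2 | _ | _ | _ | _ = balanced-≤2 v ≤2
      ... | no ≰2 | yes ≤4 | _ | _ | _ = balanced-3-4 v (≰⇒> ≰2) ≤4
      ... | _ | _ | yes ≡5 | _ | _ = balanced-5 v ≡5
      ... | _ | _ | _ | yes ≡6 | _ = balanced-6 v ≡6
      ... | _ | _ | _ | _ | yes ≡7 = balanced-7 v ≡7
      ... | _ | no ≰4 | no ≢5 | no ≢6 | no ≢7 =
        balanced-≥8 v (≤∧≢⇒< (≤∧≢⇒< (≤∧≢⇒< (≰⇒> ≰4) (≢5 ∘ sym)) (≢6 ∘ sym)) (≢7 ∘ sym))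

      degree-sum-bound : 7 * sum deg ≤ 40 * n
      degree-sum-bound = +-cancelʳ-≤ (sum into) _ _ (begin
        7 * sum deg + sum into          ≡⟨ cong₂ _+_ (*-distribˡ-sum 7 deg) (∑-comm (λ v u → transfer u v)) ⟩
        sum (λ v → 7 * deg v) + sum out ≡⟨ ∑-distrib-+ (λ v → 7 * deg v) out ⟨
        sum (λ v → 7 * deg v + out v)   ≤⟨ sum-mono-≤ balanced ⟩
        sum (λ v → 40 + into v)         ≡⟨ ∑-distrib-+ (const 40) into ⟩
        sum {n} (const 40) + sum into   ≡⟨ cong (_+ sum into) (trans (sum-const n 40) (*-comm n 40)) ⟩
        40 * n + sum into               ∎)
        where
        open ≤-Reasoning

  module _ {A : Set} {P : Pred A 0ℓ} (P? : Decidable P) where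
    length-filter-tabulate : ∀ {n} (f : Fin n → A) → length (filter P? (tabulate f)) ≡ count (P? ∘ f)
    length-filter-tabulate {zero} f = refl
    length-filter-tabulate {suc n} f with P? (f zero)
    ... | yes _ = cong suc (length-filter-tabulate (f ∘ suc))
    ... | no _ = length-filter-tabulate (f ∘ suc)

  length-filter-cartesianProduct : ∀ {A B : Set} {P : Pred (A × B) 0ℓ} (P? : Decidable P)
    {m n} (f : Fin m → A) (g : Fin n → B) →
    length (filter P? (cartesianProduct (tabulate f) (tabulate g))) ≡ sum (λ i → count (λ j → P? (f i , g j)))
  length-filter-cartesianProduct P? {zero} f g = refl
  length-filter-cartesianProduct P? {suc m} f g = begin
    length (filter P? (row ++ rows))                          ≡⟨ cong length (filter-++ P? row rows) ⟩
    length (filter P? row ++ filter P? rows)                  ≡⟨ length-++ (filter P? row) ⟩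
    length (filter P? row) + length (filter P? rows)
      ≡⟨ cong₂ _+_ (trans (cong (length ∘ filter P?) (map-tabulate g (f zero ,_)))
                          (length-filter-tabulate P? (λ j → f zero , g j)))
                   (length-filter-cartesianProduct P? (f ∘ suc) g) ⟩
    sum (λ i → count (λ j → P? (f i , g j)))                  ∎
    where
    open ≡-Reasoning
    row = map (f zero ,_) (tabulate g)
    rows = cartesianProduct (tabulate (f ∘ suc)) (tabulate g)

  module _ {n} (G : SimpleGraph (Fin n)) where
    open SimpleGraph G

    handshake : sum (degree G) ≡ edgeCount G + edgeCount G
    handshake = begin
      sum (λ u → sum (λ v → 𝟙 (u ~? v)))
        ≡⟨ sum-cong-≗ (λ u → trans (sum-cong-≗ (split u))
             (∑-distrib-+ (λ v → 𝟙 (isEdge? G (u , v))) (λ v → 𝟙 (isEdge? G (v , u))))) ⟩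
      sum (λ u → sum (λ v → 𝟙 (isEdge? G (u , v))) + sum (λ v → 𝟙 (isEdge? G (v , u))))
        ≡⟨ ∑-distrib-+ (λ u → sum (λ v → 𝟙 (isEdge? G (u , v)))) (λ u → sum (λ v → 𝟙 (isEdge? G (v , u)))) ⟩
      E + sum (λ u → sum (λ v → 𝟙 (isEdge? G (v , u))))
        ≡⟨ cong (E +_) (∑-comm (λ u v → 𝟙 (isEdge? G (v , u)))) ⟩
      E + E
        ≡⟨ cong₂ _+_ E≡edgeCount E≡edgeCount ⟩
      edgeCount G + edgeCount G ∎
      where
      open ≡-Reasoning
      E = sum (λ u → sum (λ v → 𝟙 (isEdge? G (u , v))))
      E≡edgeCount : E ≡ edgeCount G
      E≡edgeCount = sym (length-filter-cartesianProduct (isEdge? G) {n} {n} (λ i → i) (λ i → i))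
      split : ∀ u v → 𝟙 (u ~? v) ≡ 𝟙 (isEdge? G (u , v)) + 𝟙 (isEdge? G (v , u))
      split u v = decide (u ~? v) (Fin.<-cmp u v)
        where
        decide : Dec (u ~ v) → Tri (u Fin.< v) (u ≡ v) (v Fin.< u) → _
        decide (no u≁v) _ = trans (𝟙-no (u ~? v) u≁v) (sym (cong₂ _+_
          (𝟙-no (isEdge? G (u , v)) (u≁v ∘ proj₂)) (𝟙-no (isEdge? G (v , u)) (u≁v ∘ ~-sym ∘ proj₂))))
        decide (yes u~v) (tri< u<v _ v≮u) = trans (𝟙-yes (u ~? v) u~v) (sym (cong₂ _+_
          (𝟙-yes (isEdge? G (u , v)) (u<v , u~v)) (𝟙-no (isEdge? G (v , u)) (v≮u ∘ proj₁))))
        decide (yes u~v) (tri≈ _ u≡v _) = ⊥-elim (~-irr u≡v u~v)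
        decide (yes u~v) (tri> u≮v _ v<u) = trans (𝟙-yes (u ~? v) u~v) (sym (cong₂ _+_
          (𝟙-no (isEdge? G (u , v)) (u≮v ∘ proj₁)) (𝟙-yes (isEdge? G (v , u)) (v<u , ~-sym u~v))))

    edge-bound : Planar G → ¬ Contains G (doubleStar 2 5) → 7 * edgeCount G ≤ 20 * n
    edge-bound planar free = *-cancelˡ-≤ 2 (begin
      2 * (7 * edgeCount G)               ≡⟨ solve 1 (λ e → con 2 :* (con 7 :* e) := con 7 :* (e :+ e)) refl (edgeCount G) ⟩
      7 * (edgeCount G + edgeCount G)     ≡⟨ cong (7 *_) handshake ⟨
      7 * sum (degree G)                  ≤⟨ degree-sum-bound G free (planar⇒K₃₃-free G planar) ⟩
      40 * n                              ≡⟨ *-assoc 2 20 n ⟩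
      2 * (20 * n)                        ∎)
      where
      open ≤-Reasoning
      open +-*-Solver

  ratio-bound : ∀ e n → 7 * e ≤ 20 * n → ℤ.+ e ℚ./ 1 ℚ.≤ (ℤ.+ 20 ℚ./ 7) ℚ.* (ℤ.+ n ℚ./ 1)
  ratio-bound e n 7e≤20n = ℚ.toℚᵘ-cancel-≤ (begin
    ℚ.toℚᵘ (ℤ.+ e ℚ./ 1)                                  ≃⟨ ℚ.toℚᵘ-fromℚᵘ (ℤ.+ e ℚᵘ./ 1) ⟩
    ℤ.+ e ℚᵘ./ 1                                          ≤⟨ ℚᵘ.*≤* bound ⟩
    (ℤ.+ 20 ℚᵘ./ 7) ℚᵘ.* (ℤ.+ n ℚᵘ./ 1)                   ≃⟨ ℚᵘ.*-cong {ℤ.+ 20 ℚᵘ./ 7} ℚᵘ.≃-refl (ℚ.toℚᵘ-fromℚᵘ (ℤ.+ n ℚᵘ./ 1)) ⟨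
    (ℤ.+ 20 ℚᵘ./ 7) ℚᵘ.* ℚ.toℚᵘ (ℤ.+ n ℚ./ 1)             ≃⟨ ℚ.toℚᵘ-homo-* (ℤ.+ 20 ℚ./ 7) (ℤ.+ n ℚ./ 1) ⟨
    ℚ.toℚᵘ ((ℤ.+ 20 ℚ./ 7) ℚ.* (ℤ.+ n ℚ./ 1))             ∎)
    where
    open ℚᵘ.≤-Reasoning
    bound : ℤ.+ e ℤ.* ℤ.+ 7 ℤ.≤ (ℤ.+ 20 ℤ.* ℤ.+ n) ℤ.* ℤ.+ 1
    bound = subst₂ ℤ._≤_ (ℤ.pos-* e 7) (trans (ℤ.pos-* 20 n) (sym (ℤ.*-identityʳ _))) (ℤ.+≤+ (subst (_≤ 20 * n) (*-comm 7 e) 7e≤20n))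

open import Data.Integer.Base using (+_)
open import Data.Rational.Base using (_/_; _*_; _≤_)

theorem1p1 : (n : ℕ) → n ≥ 1 → (ex : ℕ) → IsPlanarTuránNumber n (doubleStar 2 5) ex →
    + ex / 1 ≤ (+ 20 / 7) * (+ n / 1)
theorem1p1 n _ ex turán with IsPlanarTuránNumber.attained turán
... | G , planar , free , refl = ratio-bound (edgeCount G) n (edge-bound G planar free)
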